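{- The $\Sigma_4$-theory of $\mathbf Y^*=\langle\mathcal P,\le,[1]+[1]\rangle$ (the set of $\Sigma_4$-sentences in the language $\{\le,[1]+[1]\}$ true in $\mathbf Y^*$) is undecidable.
   Context: $\mathcal P$ is the set of all integer partitions, including the empty partition; a partition is a nonincreasing finite sequence of positive integers. Young's lattice $\mathbf Y=\langle\mathcal P,\le\rangle$ has $(s_1,\dots,s_r)\le(n_1,\dots,n_t)$ iff $r\le t$ and $s_i\le n_i$ for all $i\le r$; $\mathbf Y^*$ is $\mathbf Y$ expanded by a constant symbol interpreted as the partition $[1]+[1]=(1,1)$. A $\Sigma_n$-sentence is a sentence in prenex form with $n$ alternating quantifier blocks, the outermost existential, and a quantifier-free matrix. -}

module Defs where

open import Data.Fin using (Fin; toℕ; inject≤)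
import Data.Fin.Properties as Fin
open import Data.List using (List; []; _∷_; length; lookup)
import Data.List.Properties as List
open import Data.List.Relation.Unary.All as All using (All; []; _∷_)
open import Data.List.Relation.Unary.Linked as Linked using (Linked; [-]; _∷_)
open import Data.Nat using (ℕ; zero; suc; _+_; _≤_; _≥_; _<_; z≤n; s≤s; _≤?_; _≟_)
open import Data.Nat.Properties
open import Data.Product using (Σ; ∃; _×_; _,_; proj₁; proj₂)
open import Data.Sum using (_⊎_)
open import Data.Vec as Vec using (Vec; []; _∷_)
open import Level using (0ℓ)
open import Relation.Binary.Definitions using (tri<; tri≈; tri>)
open import Relation.Binary.PropositionalEquality
open import Relation.Nullary using (¬_; Dec; yes; no; contradiction)
open import Relation.Nullary.Decidable using (decidable-stable; map′)
open import Relation.Nullary.Negation using (DoubleNegation)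
open import Relation.Unary using (Pred)

record Partition : Set where
  constructor partition
  field
    parts         : List ℕ
    nonincreasing : Linked _≥_ parts
    positive      : All (0 <_) parts

open Partition public

infix 4 _≤ʸ_

_≤ʸ_ : Partition → Partition → Set
p ≤ʸ q = Σ (length (parts p) ≤ length (parts q)) λ r≤t →
         ∀ i → lookup (parts p) i ≤ lookup (parts q) (inject≤ i r≤t)

[1]+[1] : Partition
[1]+[1] = partition (1 ∷ 1 ∷ []) (≤-refl ∷ [-]) (s≤s z≤n ∷ s≤s z≤n ∷ [])

parts-injective : ∀ {p q} → parts p ≡ parts q → p ≡ q
parts-injective {partition xs l a} {partition .xs l′ a′} refl =
  cong₂ (partition xs) (Linked.irrelevant ≤-irrelevant l l′)
                       (All.irrelevant ≤-irrelevant a a′)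

infix 4 _≤ʸ?_ _≟ʸ_

_≤ʸ?_ : ∀ p q → Dec (p ≤ʸ q)
p ≤ʸ? q with length (parts p) ≤? length (parts q)
... | no  r≰t = no λ p≤q → r≰t (proj₁ p≤q)
... | yes r≤t = map′ (r≤t ,_)
  (λ (r≤t′ , h) i → subst (λ e → lookup (parts p) i ≤ lookup (parts q) (inject≤ i e))
                          (≤-irrelevant r≤t′ r≤t) (h i))
  (Fin.all? λ i → lookup (parts p) i ≤? lookup (parts q) (inject≤ i r≤t))

_≟ʸ_ : ∀ (p q : Partition) → Dec (p ≡ q)
p ≟ʸ q = map′ parts-injective (cong parts) (List.≡-dec _≟_ (parts p) (parts q))

-- Variables are de Bruijn indices; Formula n has its free variables among
-- the first n of them.

data Term (n : ℕ) : Set where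
  var : Fin n → Term n
  c   : Term n

data Quantifier : Set where
  all ex : Quantifier

data Formula (n : ℕ) : Set where
  _≼_ _≐_        : Term n → Term n → Formula n
  ¬′_            : Formula n → Formula n
  _∧′_ _∨′_ _⇒′_ : Formula n → Formula n → Formula n
  quant          : Quantifier → Formula (suc n) → Formula n

Sentence : Set
Sentence = Formula 0

data QuantifierFree {n} : Formula n → Set where
  _≼_  : ∀ s t → QuantifierFree (s ≼ t)
  _≐_  : ∀ s t → QuantifierFree (s ≐ t)
  ¬′_  : ∀ {φ} → QuantifierFree φ → QuantifierFree (¬′ φ)
  _∧′_ : ∀ {φ ψ} → QuantifierFree φ → QuantifierFree ψ → QuantifierFree (φ ∧′ ψ)
  _∨′_ : ∀ {φ ψ} → QuantifierFree φ → QuantifierFree ψ → QuantifierFree (φ ∨′ ψ)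
  _⇒′_ : ∀ {φ ψ} → QuantifierFree φ → QuantifierFree ψ → QuantifierFree (φ ⇒′ ψ)

dual : Quantifier → Quantifier
dual all = ex
dual ex  = all

-- Prenex q k φ: φ is prenex with exactly k alternating nonempty blocks of
-- quantifiers, the outermost (when k > 0) consisting of q's.

data Prenex {n} : Quantifier → ℕ → Formula n → Set where
  matrix : ∀ {q φ} → QuantifierFree φ → Prenex q 0 φ
  new    : ∀ {q k φ} → Prenex (dual q) k φ → Prenex q (suc k) (quant q φ)
  extend : ∀ {q k φ} → Prenex q (suc k) φ → Prenex q (suc k) (quant q φ)

Σ[_] : ∀ {n} → ℕ → Formula n → Set
Σ[ k ] = Prenex ex k

value : ∀ {n} → Vec Partition n → Term n → Partition
value ρ (var i) = Vec.lookup ρ i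
value ρ c       = [1]+[1]

-- Truth is classical: ∨ and ∃ are double-negated, so that (since the atomic
-- formulas are decidable) every formula is stable and obeys classical logic,
-- see ⊨-stable. Under excluded middle these are the usual Tarski clauses.

infix 4 _⊨_

_⊨_ : ∀ {n} → Vec Partition n → Formula n → Set
ρ ⊨ s ≼ t       = value ρ s ≤ʸ value ρ t
ρ ⊨ s ≐ t       = value ρ s ≡ value ρ t
ρ ⊨ ¬′ φ        = ¬ ρ ⊨ φ
ρ ⊨ φ ∧′ ψ      = ρ ⊨ φ × ρ ⊨ ψ
ρ ⊨ φ ∨′ ψ      = DoubleNegation (ρ ⊨ φ ⊎ ρ ⊨ ψ)
ρ ⊨ φ ⇒′ ψ      = ρ ⊨ φ → ρ ⊨ ψ
ρ ⊨ quant all φ = ∀ p → (p ∷ ρ) ⊨ φ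
ρ ⊨ quant ex  φ = DoubleNegation (∃ λ p → (p ∷ ρ) ⊨ φ)

⊨-stable : ∀ {n} (ρ : Vec Partition n) φ → DoubleNegation (ρ ⊨ φ) → ρ ⊨ φ
⊨-stable ρ (s ≼ t)       h = decidable-stable (value ρ s ≤ʸ? value ρ t) h
⊨-stable ρ (s ≐ t)       h = decidable-stable (value ρ s ≟ʸ value ρ t) h
⊨-stable ρ (¬′ φ)        h = λ x → h λ ¬x → ¬x x
⊨-stable ρ (φ ∧′ ψ)      h = ⊨-stable ρ φ (λ k → h λ (x , _) → k x)
                           , ⊨-stable ρ ψ (λ k → h λ (_ , y) → k y)
⊨-stable ρ (φ ∨′ ψ)      h = λ k → h λ x → x k
⊨-stable ρ (φ ⇒′ ψ)      h = λ x → ⊨-stable ρ ψ λ k → h λ f → k (f x)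
⊨-stable ρ (quant all φ) h = λ p → ⊨-stable (p ∷ ρ) φ λ k → h λ f → k (f p)
⊨-stable ρ (quant ex φ)  h = λ k → h λ x → x k

Σ-Theory : ℕ → Pred Sentence 0ℓ
Σ-Theory k φ = Σ[ k ] φ × [] ⊨ φ

-- pair is Cantor's pairing function; ⌜⌝-injective shows that ⌜_⌝ is a coding.

triangle : ℕ → ℕ
triangle zero    = 0
triangle (suc n) = triangle n + suc n

pair : ℕ → ℕ → ℕ
pair a b = triangle (a + b) + b

⌜_⌝ᵗ : ∀ {n} → Term n → ℕ
⌜ c ⌝ᵗ     = 0
⌜ var i ⌝ᵗ = suc (toℕ i)

tag : ∀ {n} → Formula n → ℕ
tag (_ ≼ _)       = 0
tag (_ ≐ _)       = 1
tag (¬′ _)        = 2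
tag (_ ∧′ _)      = 3
tag (_ ∨′ _)      = 4
tag (_ ⇒′ _)      = 5
tag (quant all _) = 6
tag (quant ex _)  = 7

mutual
  ⌜_⌝ : ∀ {n} → Formula n → ℕ
  ⌜ φ ⌝ = pair (tag φ) (body φ)

  body : ∀ {n} → Formula n → ℕ
  body (s ≼ t)     = pair ⌜ s ⌝ᵗ ⌜ t ⌝ᵗ
  body (s ≐ t)     = pair ⌜ s ⌝ᵗ ⌜ t ⌝ᵗ
  body (¬′ φ)      = ⌜ φ ⌝
  body (φ ∧′ ψ)    = pair ⌜ φ ⌝ ⌜ ψ ⌝
  body (φ ∨′ ψ)    = pair ⌜ φ ⌝ ⌜ ψ ⌝
  body (φ ⇒′ ψ)    = pair ⌜ φ ⌝ ⌜ ψ ⌝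
  body (quant _ φ) = ⌜ φ ⌝

triangle-mono : ∀ {m n} → m ≤ n → triangle m ≤ triangle n
triangle-mono z≤n     = z≤n
triangle-mono (s≤s h) = +-mono-≤ (triangle-mono h) (s≤s h)

pair-< : ∀ a b a′ b′ → a + b < a′ + b′ → pair a b < pair a′ b′
pair-< a b a′ b′ h = begin-strict
  triangle (a + b) + b           <⟨ +-monoʳ-< (triangle (a + b)) (s≤s (m≤n+m b a)) ⟩
  triangle (suc (a + b))         ≤⟨ triangle-mono h ⟩
  triangle (a′ + b′)             ≤⟨ m≤m+n _ b′ ⟩
  triangle (a′ + b′) + b′        ∎
  where open ≤-Reasoning

pair-injective : ∀ a b a′ b′ → pair a b ≡ pair a′ b′ → a ≡ a′ × b ≡ b′
pair-injective a b a′ b′ eq with <-cmp (a + b) (a′ + b′)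
... | tri< h _ _ = contradiction eq (<⇒≢ (pair-< a b a′ b′ h))
... | tri> _ _ h = contradiction (sym eq) (<⇒≢ (pair-< a′ b′ a b h))
... | tri≈ _ h _ = +-cancelʳ-≡ b a a′ (trans h (cong (a′ +_) (sym b≡b′))) , b≡b′
  where
  b≡b′ : b ≡ b′
  b≡b′ = +-cancelˡ-≡ (triangle (a + b)) b b′
           (trans eq (cong (λ s → triangle s + b′) (sym h)))

⌜⌝ᵗ-injective : ∀ {n} (s t : Term n) → ⌜ s ⌝ᵗ ≡ ⌜ t ⌝ᵗ → s ≡ t
⌜⌝ᵗ-injective c       c       _  = refl
⌜⌝ᵗ-injective (var i) (var j) eq = cong var (Fin.toℕ-injective (suc-injective eq))

mutual
  ⌜⌝-injective : ∀ {n} (φ ψ : Formula n) → ⌜ φ ⌝ ≡ ⌜ ψ ⌝ → φ ≡ ψ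
  ⌜⌝-injective φ ψ eq =
    let t , b = pair-injective (tag φ) (body φ) (tag ψ) (body ψ) eq
    in body-injective φ ψ t b

  body-injective : ∀ {n} (φ ψ : Formula n) → tag φ ≡ tag ψ → body φ ≡ body ψ → φ ≡ ψ
  body-injective (s ≼ t)       (s′ ≼ t′)     refl eq = terms _≼_ s t s′ t′ eq
  body-injective (s ≐ t)       (s′ ≐ t′)     refl eq = terms _≐_ s t s′ t′ eq
  body-injective (¬′ φ)        (¬′ ψ)        refl eq = cong ¬′_ (⌜⌝-injective φ ψ eq)
  body-injective (φ ∧′ ψ)      (φ′ ∧′ ψ′)    refl eq = formulas _∧′_ φ ψ φ′ ψ′ eq
  body-injective (φ ∨′ ψ)      (φ′ ∨′ ψ′)    refl eq = formulas _∨′_ φ ψ φ′ ψ′ eq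
  body-injective (φ ⇒′ ψ)      (φ′ ⇒′ ψ′)    refl eq = formulas _⇒′_ φ ψ φ′ ψ′ eq
  body-injective (quant all φ) (quant all ψ) refl eq = cong (quant all) (⌜⌝-injective φ ψ eq)
  body-injective (quant ex φ)  (quant ex ψ)  refl eq = cong (quant ex) (⌜⌝-injective φ ψ eq)
  body-injective (_ ≼ _)       (quant all _) ()
  body-injective (_ ≐ _)       (quant all _) ()
  body-injective (¬′ _)        (quant all _) ()
  body-injective (_ ∧′ _)      (quant all _) ()
  body-injective (_ ∨′ _)      (quant all _) ()
  body-injective (_ ⇒′ _)      (quant all _) ()

  terms : ∀ {n} (f : Term n → Term n → Formula n) s t s′ t′ →
          pair ⌜ s ⌝ᵗ ⌜ t ⌝ᵗ ≡ pair ⌜ s′ ⌝ᵗ ⌜ t′ ⌝ᵗ → f s t ≡ f s′ t′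
  terms f s t s′ t′ eq =
    let l , r = pair-injective ⌜ s ⌝ᵗ ⌜ t ⌝ᵗ ⌜ s′ ⌝ᵗ ⌜ t′ ⌝ᵗ eq
    in cong₂ f (⌜⌝ᵗ-injective s s′ l) (⌜⌝ᵗ-injective t t′ r)

  formulas : ∀ {n} (f : Formula n → Formula n → Formula n) φ ψ φ′ ψ′ →
             pair ⌜ φ ⌝ ⌜ ψ ⌝ ≡ pair ⌜ φ′ ⌝ ⌜ ψ′ ⌝ → f φ ψ ≡ f φ′ ψ′
  formulas f φ ψ φ′ ψ′ eq =
    let l , r = pair-injective ⌜ φ ⌝ ⌜ ψ ⌝ ⌜ φ′ ⌝ ⌜ ψ′ ⌝ eq
    in cong₂ f (⌜⌝-injective φ φ′ l) (⌜⌝-injective ψ ψ′ r)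

data Rec : ℕ → Set where
  zer  : Rec 0
  succ : Rec 1
  proj : ∀ {n} → Fin n → Rec n
  comp : ∀ {m n} → Rec m → Vec (Rec n) m → Rec n
  prec : ∀ {n} → Rec n → Rec (2 + n) → Rec (suc n)
  μ    : ∀ {n} → Rec (suc n) → Rec n

-- f [ xs ]↓ y: f is defined at xs, with value y. The recursion variable is
-- the first argument of prec g h, the search variable the first one of f in
-- μ f, and h receives the recursion index, the previous value and the
-- parameters, in this order.

infix 4 _[_]↓_ _[_]⇓_

mutual
  data _[_]↓_ : ∀ {n} → Rec n → Vec ℕ n → ℕ → Set where
    zer↓  : zer [ [] ]↓ 0
    succ↓ : ∀ {x} → succ [ x ∷ [] ]↓ suc x
    proj↓ : ∀ {n} {i : Fin n} {xs} → proj i [ xs ]↓ Vec.lookup xs i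
    comp↓ : ∀ {m n} {f : Rec m} {gs : Vec (Rec n) m} {xs ys z} →
            gs [ xs ]⇓ ys → f [ ys ]↓ z → comp f gs [ xs ]↓ z
    prec↓-zero : ∀ {n} {g : Rec n} {h xs y} →
                 g [ xs ]↓ y → prec g h [ 0 ∷ xs ]↓ y
    prec↓-suc  : ∀ {n} {g : Rec n} {h k xs y z} →
                 prec g h [ k ∷ xs ]↓ y → h [ k ∷ y ∷ xs ]↓ z →
                 prec g h [ suc k ∷ xs ]↓ z
    μ↓    : ∀ {n} {f : Rec (suc n)} {xs y} →
            (∀ k → k < y → ∃ λ v → f [ k ∷ xs ]↓ suc v) →
            f [ y ∷ xs ]↓ 0 → μ f [ xs ]↓ y

  data _[_]⇓_ : ∀ {m n} → Vec (Rec n) m → Vec ℕ n → Vec ℕ m → Set where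
    []  : ∀ {n} {xs : Vec ℕ n} → [] [ xs ]⇓ []
    _∷_ : ∀ {m n} {g : Rec n} {gs : Vec (Rec n) m} {xs y ys} →
          g [ xs ]↓ y → gs [ xs ]⇓ ys → (g ∷ gs) [ xs ]⇓ (y ∷ ys)

_Decides_ : Rec 1 → Pred ℕ 0ℓ → Set
f Decides A = ∀ k → (A k → f [ k ∷ [] ]↓ 1) × (¬ A k → f [ k ∷ [] ]↓ 0)

Codes : Pred Sentence 0ℓ → Pred ℕ 0ℓ
Codes T k = ∃ λ φ → T φ × ⌜ φ ⌝ ≡ k

Undecidable : Pred Sentence 0ℓ → Set
Undecidable T = ¬ ∃ λ f → f Decides Codes T

{-# OPTIONS --safe #-}

-- A register machine computation is stored in Young's lattice by one partition
-- per register: at time t the register holds p ! t - q ! t, where the part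
-- q ! t of the base partition q drops by one at every step. Keeping,
-- incrementing or resetting a register then means p ! (t + 1) = p ! t - 1,
-- p ! (t + 1) = p ! t or p ! (t + 1) = q ! (t + 1), so no addition of parts is
-- needed. Rows are the partitions not containing [1]+[1], columns those not
-- containing (2), and the rectangle with given sides is the largest partition
-- that contains neither a certain row nor a certain column; rectangles below p
-- read off the parts of p. Hence the transition rules become ∀∃ conditions on
-- the outermost existential block.
--
-- For a matrix φ describing a machine let S k φ say that the machine reaches its
-- goal on input k; here k enters only as the length of a chain of existentially
-- quantified rows, so the code of S k φ is computable from k and the code of φ.
-- If a recursive f decided the theory, some machine would reach its goal on
-- input k iff f rejects the sentence S k φ with k = ⌜φ⌝. For its own matrix φ
-- and k = ⌜φ⌝ the verdict of f on S k φ is wrong.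

module Submission where

open import Defs
open import Data.Empty using (⊥)
open import Data.Fin using (zero; suc; inject≤)
open import Data.List as List using (List; []; _∷_; length; concatMap)
open import Data.List.Membership.Propositional using (_∈_; find; lose)
open import Data.List.Membership.Propositional.Properties
  using (∈-map⁺; ∈-++⁺ˡ; ∈-++⁺ʳ; ∈-concatMap⁺; ∈-concatMap⁻)
open import Data.List.Relation.Unary.All using (All; []; _∷_)
open import Data.List.Relation.Unary.Any using (here; there)
open import Data.List.Relation.Unary.Linked using (Linked; []; [-]; _∷_)
open import Data.Maybe as Maybe using (Maybe; just; nothing)
open import Data.Nat using (ℕ; zero; suc; _+_; _∸_; _≤_; _<_; _≥_; z≤n; s≤s; _≟_; _≤?_)
open import Data.Nat.Properties
open import Data.Product using (Σ; ∃; _×_; _,_; proj₁; proj₂)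
open import Data.Sum as Sum using (_⊎_; inj₁; inj₂)
open import Data.Sum.Properties using (inj₁-injective; inj₂-injective)
open import Data.Unit using (⊤; tt)
open import Data.Vec as Vec using (Vec; []; _∷_; _++_)
open import Data.Vec.Properties using (∷-injective; lookup-map)
open import Data.Vec.Relation.Unary.All as VecAll using ([]; _∷_)
open import Data.Vec.Relation.Unary.All.Properties using (lookup⁺)
open import Function using (_∘_; id)
open import Relation.Binary.Definitions using (tri<; tri≈; tri>)
open import Relation.Binary.PropositionalEquality
open import Relation.Nullary using (¬_; Dec; yes; no; contradiction)
open import Relation.Nullary.Decidable using (decidable-stable; ¬?; _×-dec_; _→-dec_)
open import Relation.Nullary.Negation using (DoubleNegation)

-- Register programs for recursive functions

-- Parts of a partition never increase while registers do. The slope of `q` makes up for this as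
-- long as no register gains more than one per step, which shapes the instruction set. The
-- quantifier count rests on polarity. Successors and rectangles are defined by a condition on all
-- `𝕫`. These definitions appear only as the premise of the transition rules, so `𝕫` becomes
-- existential: the blocks are ∃ for the computation, ∀ for rows, columns and rectangles, ∃ for `𝕫`,
-- and a last ∀ completing the four. What is asserted outright, such as that `𝕕` is (2) or that the
-- chain descends by ones, is tested by the universal variable `𝕪` instead. A satisfying `q` may
-- have any height, so the falsity of a sentence has to come from an endless history; hence the
-- verdict 1 of f is turned into an endless loop and the verdict 0 into halting. No machine has to
-- know its own code, which arrives as the input k. The same k is the number of variables reserved
-- for the parameters: it bounds every name in the matrix, so the code of the sentence is computed
-- without inspecting that matrix.

-- until m n c repeats c as long as the registers m and n differ.
infixr 5 _⨾_
data Command : Set where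
  clear incr : ℕ → Command
  _⨾_        : Command → Command → Command
  until      : ℕ → ℕ → Command → Command

Store : Set
Store = ℕ → ℕ

infix 7 _[_≔_]
_[_≔_] : Store → ℕ → ℕ → Store
(ρ [ r ≔ x ]) i with i ≟ r
... | yes _ = x
... | no  _ = ρ i

≔-same : ∀ (ρ : Store) r x → (ρ [ r ≔ x ]) r ≡ x
≔-same ρ r x with r ≟ r
... | yes _ = refl
... | no r≢r = contradiction refl r≢r

≔-other : ∀ (ρ : Store) r x {i} → i ≢ r → (ρ [ r ≔ x ]) i ≡ ρ i
≔-other ρ r x {i} i≢r with i ≟ r
... | yes i≡r = contradiction i≡r i≢r
... | no _ = refl

infix 4 _⊢_⇒_
data _⊢_⇒_ : Command → Store → Store → Set where
  clear : ∀ {r ρ} → clear r ⊢ ρ ⇒ ρ [ r ≔ 0 ]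
  incr  : ∀ {r ρ} → incr r ⊢ ρ ⇒ ρ [ r ≔ suc (ρ r) ]
  _⨾_   : ∀ {a b ρ ρ′ ρ″} → a ⊢ ρ ⇒ ρ′ → b ⊢ ρ′ ⇒ ρ″ → a ⨾ b ⊢ ρ ⇒ ρ″
  stop  : ∀ {m n a ρ} → ρ m ≡ ρ n → until m n a ⊢ ρ ⇒ ρ
  again : ∀ {m n a ρ ρ′ ρ″} → ρ m ≢ ρ n →
          a ⊢ ρ ⇒ ρ′ → until m n a ⊢ ρ′ ⇒ ρ″ → until m n a ⊢ ρ ⇒ ρ″

copy : ℕ → ℕ → Command
copy i o = clear o ⨾ until i o (incr o)

range : ℕ → ∀ m → Vec ℕ m
range b zero    = []
range b (suc m) = b ∷ range (suc b) m

-- compile f is o b evaluates f on the registers is and stores the result in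
-- register o; the registers from b on are scratch space.
mutual
  compile : ∀ {n} → Rec n → Vec ℕ n → ℕ → ℕ → Command
  compile zer            is       o b = clear o
  compile succ           (i ∷ []) o b = copy i o ⨾ incr o
  compile (proj j)       is       o b = copy (Vec.lookup is j) o
  compile (comp {m} f gs) is      o b =
    compileAll gs is b (m + b) ⨾ compile f (range b m) o (m + b)
  compile (prec g h)     (n ∷ is) o b =
    (compile g is o b ⨾ clear b) ⨾
    -- `h` reads `o` while it runs, so its value is built in `1 + b` and copied to `o` only
    -- afterwards.
    until b n (compile h (b ∷ o ∷ is) (1 + b) (2 + b) ⨾ copy (1 + b) o ⨾ incr b)
  compile (μ f)          is       o b =
    -- `until` compares two registers, so a test for zero needs a register that holds 0; here it is
    -- `b`.
    (clear o ⨾ clear b ⨾ compile f (o ∷ is) (1 + b) (2 + b)) ⨾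
    until (1 + b) b (incr o ⨾ compile f (o ∷ is) (1 + b) (2 + b))

  compileAll : ∀ {m n} → Vec (Rec n) m → Vec ℕ n → ℕ → ℕ → Command
  -- There is no empty command; clearing the scratch register `b`, which lies beyond all targets,
  -- stands in for it.
  compileAll []       is o b = clear b
  compileAll (g ∷ gs) is o b = compile g is o b ⨾ compileAll gs is (suc o) b

copy-correct : ∀ {i o} → i ≢ o → ∀ ρ →
  ∃ λ ρ′ → copy i o ⊢ ρ ⇒ ρ′ × ρ′ o ≡ ρ i × (∀ j → j ≢ o → ρ′ j ≡ ρ j)
copy-correct {i} {o} i≢o ρ =
  let ρ′ , run , eq , frame = loop (ρ i) (ρ [ o ≔ 0 ])
        (trans (≔-other ρ o 0 i≢o)
               (sym (trans (cong (ρ i +_) (≔-same ρ o 0)) (+-identityʳ (ρ i)))))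
  in ρ′ , clear ⨾ run , trans eq (≔-other ρ o 0 i≢o)
   , λ j j≢o → trans (frame j j≢o) (≔-other ρ o 0 j≢o)
  where
  loop : ∀ d ρ → ρ i ≡ d + ρ o →
    ∃ λ ρ′ → until i o (incr o) ⊢ ρ ⇒ ρ′ × ρ′ o ≡ ρ i × (∀ j → j ≢ o → ρ′ j ≡ ρ j)
  loop zero    ρ eq = ρ , stop eq , sym eq , λ _ _ → refl
  loop (suc d) ρ eq =
    let ρ₁ = ρ [ o ≔ suc (ρ o) ]
        at-i = ≔-other ρ o (suc (ρ o)) i≢o
        ρ′ , run , eq′ , frame = loop d ρ₁ (begin
          ρ₁ i          ≡⟨ at-i ⟩
          ρ i           ≡⟨ eq ⟩
          suc d + ρ o   ≡⟨ +-suc d (ρ o) ⟨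
          d + suc (ρ o) ≡⟨ cong (d +_) (≔-same ρ o (suc (ρ o))) ⟨
          d + ρ₁ o      ∎)
    in ρ′ , again (λ e → m≢1+n+m (ρ o) (trans (sym e) eq)) incr run
     , trans eq′ at-i
     , λ j j≢o → trans (frame j j≢o) (≔-other ρ o (suc (ρ o)) j≢o)
    where open ≡-Reasoning

Computes : Command → Store → ℕ → ℕ → ℕ → Set
Computes a ρ o b y =
  ∃ λ ρ′ → a ⊢ ρ ⇒ ρ′ × ρ′ o ≡ y × (∀ i → i < b → i ≢ o → ρ′ i ≡ ρ i)

map-cong-All : ∀ {P : ℕ → Set} {n} {ρ ρ′ : Store} {is : Vec ℕ n} →
               (∀ i → P i → ρ′ i ≡ ρ i) → VecAll.All P is → Vec.map ρ′ is ≡ Vec.map ρ is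
map-cong-All h []       = refl
map-cong-All h (p ∷ ps) = cong₂ _∷_ (h _ p) (map-cong-All h ps)

range-bounds : ∀ {o} b m → o < b → VecAll.All (λ i → i < m + b × i ≢ o) (range b m)
range-bounds b zero    o<b = []
range-bounds {o} b (suc m) o<b =
  (s≤s (m≤n+m b m) , λ b≡o → <⇒≢ o<b (sym b≡o)) ∷
  subst (λ s → VecAll.All (λ i → i < s × i ≢ o) (range (suc b) m)) (+-suc m b)
        (range-bounds (suc b) m (m<n⇒m<1+n o<b))

-- A compiled program may overwrite `o` before its last read of an argument (`copy` clears it at
-- once), so arguments must differ from `o`.
Safe : ℕ → ℕ → ℕ → Set
Safe b o i = i < b × i ≢ o

scratch : ∀ {n} {is : Vec ℕ n} {o b} → VecAll.All (Safe b o) is → VecAll.All (Safe (2 + b) (suc b)) is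
scratch = VecAll.map λ (i<b , _) → m<n⇒m<1+n (m<n⇒m<1+n i<b) , <⇒≢ (m<n⇒m<1+n i<b)

Evaluates : ∀ {n} → Rec n → Vec ℕ n → ℕ → Set
Evaluates {n} f xs y = ∀ ρ (is : Vec ℕ n) o b → Vec.map ρ is ≡ xs → VecAll.All (Safe b o) is → o < b →
                       Computes (compile f is o b) ρ o b y

preserved : ∀ {n b o ρ ρ′} {is : Vec ℕ n} {xs} → (∀ i → i < b → i ≢ o → ρ′ i ≡ ρ i) →
            VecAll.All (Safe b o) is → Vec.map ρ is ≡ xs → Vec.map ρ′ is ≡ xs
preserved frame safe eqs =
  trans (map-cong-All (λ i (i<b , i≢o) → frame i i<b i≢o) safe) eqs

-- The search ends at y since all earlier values are nonzero. The correctness of `f` enters as an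
-- argument, which keeps this lemma outside the induction on derivations.
μ-evaluates : ∀ {n} {f : Rec (suc n)} {xs y} →
              (∀ k → k < y → ∃ λ v → Evaluates f (k ∷ xs) (suc v)) →
              Evaluates f (y ∷ xs) 0 → Evaluates (μ f) xs y
μ-evaluates {f = f} {xs} {y} below at-y ρ is o b eqs safe o<b =
  let ρ₁ = ρ [ o ≔ 0 ]
      ρ₂ = ρ₁ [ b ≔ 0 ]
      o≡0 = trans (≔-other ρ₁ b 0 (<⇒≢ o<b)) (≔-same ρ o 0)
      frame₂ = λ i i<b i≢o → trans (≔-other ρ₁ b 0 (<⇒≢ i<b)) (≔-other ρ o 0 i≢o)
      ρ₃ , run₃ , tested , frame₃ = test y 0 ρ₂ (+-identityʳ y) o≡0 (preserved frame₂ safe eqs)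
      frame₃′ = λ i i<b i≢o → trans (frame₃ i (≤-trans i<b (n≤1+n b))) (frame₂ i i<b i≢o)
      ρ₄ , run₄ , eq₄ , frame₄ =
        search y 0 ρ₃ (+-identityʳ y) (trans (frame₃ o (m<n⇒m<1+n o<b)) o≡0)
          (trans (frame₃ b ≤-refl) (≔-same ρ₁ b 0)) tested (preserved frame₃′ safe eqs)
  in ρ₄ , (clear ⨾ clear ⨾ run₃) ⨾ run₄ , eq₄
   , λ i i<b i≢o → trans (frame₄ i i<b i≢o) (frame₃′ i i<b i≢o)
  where
  f-at-o : Command
  f-at-o = compile f (o ∷ is) (1 + b) (2 + b)

  -- The first argument is the distance still to go to y; of the value of `f`, the loop sees only
  -- whether it is zero.
  Tested : ℕ → ℕ → Set
  Tested zero    v = v ≡ 0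
  Tested (suc _) v = v ≢ 0

  run-f : ∀ {j v} → Evaluates f (j ∷ xs) v → ∀ ρ₁ → ρ₁ o ≡ j → Vec.map ρ₁ is ≡ xs →
          ∃ λ ρ₂ → f-at-o ⊢ ρ₁ ⇒ ρ₂ × ρ₂ (1 + b) ≡ v × (∀ i → i < 1 + b → ρ₂ i ≡ ρ₁ i)
  run-f eval ρ₁ eq-o eqs₁ =
    let ρ₂ , run , eq , frame =
          eval ρ₁ (o ∷ is) (1 + b) (2 + b) (cong₂ _∷_ eq-o eqs₁)
            ((m<n⇒m<1+n (m<n⇒m<1+n o<b) , <⇒≢ (m<n⇒m<1+n o<b)) ∷ scratch safe) ≤-refl
    in ρ₂ , run , eq , λ i i<1+b → frame i (m<n⇒m<1+n i<1+b) (<⇒≢ i<1+b)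

  test : ∀ d j ρ₁ → d + j ≡ y → ρ₁ o ≡ j → Vec.map ρ₁ is ≡ xs →
         ∃ λ ρ₂ → f-at-o ⊢ ρ₁ ⇒ ρ₂ × Tested d (ρ₂ (1 + b)) × (∀ i → i < 1 + b → ρ₂ i ≡ ρ₁ i)
  test zero    j ρ₁ refl eq-o eqs₁ = run-f at-y ρ₁ eq-o eqs₁
  test (suc d) j ρ₁ refl eq-o eqs₁ =
    let _ , eval = below j (s≤s (m≤n+m j d))
        ρ₂ , run , eq , frame = run-f eval ρ₁ eq-o eqs₁
    in ρ₂ , run , (λ e → 1+n≢0 (trans (sym eq) e)) , frame

  search : ∀ d j ρ₁ → d + j ≡ y → ρ₁ o ≡ j → ρ₁ b ≡ 0 → Tested d (ρ₁ (1 + b)) →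
           Vec.map ρ₁ is ≡ xs → Computes (until (1 + b) b (incr o ⨾ f-at-o)) ρ₁ o b y
  search zero    j ρ₁ refl eq-o eq-b tested _ =
    ρ₁ , stop (trans tested (sym eq-b)) , eq-o , λ _ _ _ → refl
  search (suc d) j ρ₁ refl eq-o eq-b tested eqs₁ =
    let ρ₂ = ρ₁ [ o ≔ suc (ρ₁ o) ]
        frame₂ = λ i (i≢o : i ≢ o) → ≔-other ρ₁ o (suc (ρ₁ o)) i≢o
        eq-o₂ = trans (≔-same ρ₁ o _) (cong suc eq-o)
        ρ₃ , run₃ , tested₃ , frame₃ =
          test d (suc j) ρ₂ (+-suc d j) eq-o₂ (preserved {b = b} (λ i _ → frame₂ i) safe eqs₁)
        frame₃′ = λ i i<b i≢o → trans (frame₃ i (m<n⇒m<1+n i<b)) (frame₂ i i≢o)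
        ρ₄ , run₄ , eq₄ , frame₄ =
          search d (suc j) ρ₃ (+-suc d j) (trans (frame₃ o (m<n⇒m<1+n o<b)) eq-o₂)
            (trans (frame₃ b ≤-refl) (trans (frame₂ b (λ b≡o → <⇒≢ o<b (sym b≡o))) eq-b))
            tested₃ (preserved frame₃′ safe eqs₁)
    in ρ₄ , again (λ e → tested (trans e eq-b)) (incr ⨾ run₃) run₄ , eq₄
     , λ i i<b i≢o → trans (frame₄ i i<b i≢o) (frame₃′ i i<b i≢o)

mutual
  compile-correct : ∀ {n} {f : Rec n} {xs y} → f [ xs ]↓ y → Evaluates f xs y
  compile-correct zer↓ ρ is o b _ _ _ =
    _ , clear , ≔-same ρ o 0 , λ i _ i≢o → ≔-other ρ o 0 i≢o
  compile-correct succ↓ ρ (i ∷ []) o b refl ((_ , i≢o) ∷ []) _ =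
    let ρ′ , run , eq , frame = copy-correct i≢o ρ
    in _ , run ⨾ incr , trans (≔-same ρ′ o _) (cong suc eq)
     , λ j _ j≢o → trans (≔-other ρ′ o _ j≢o) (frame j j≢o)
  compile-correct (proj↓ {i = j}) ρ is o b refl safe _ =
    let ρ′ , run , eq , frame = copy-correct (proj₂ (lookup⁺ safe j)) ρ
    in ρ′ , run , trans eq (sym (lookup-map j ρ is)) , λ i _ → frame i
  compile-correct (comp↓ {m} gs↓ f↓) ρ is o b eqs safe o<b =
    let ρ₁ , run₁ , eqs₁ , frame₁ =
          compileAll-correct gs↓ ρ is b (m + b) eqs (VecAll.map proj₁ safe) ≤-refl
        ρ₂ , run₂ , eq₂ , frame₂ =
          compile-correct f↓ ρ₁ (range b m) o (m + b) eqs₁ (range-bounds b m o<b)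
                          (m≤n⇒m≤o+n m o<b)
    in ρ₂ , run₁ ⨾ run₂ , eq₂
     , λ i i<b i≢o → trans (frame₂ i (m≤n⇒m≤o+n m i<b) i≢o) (frame₁ i i<b)
  compile-correct r@(prec↓-zero _) ρ is o b eqs safe o<b = prec-correct r ρ is o b eqs safe o<b
  compile-correct r@(prec↓-suc _ _) ρ is o b eqs safe o<b = prec-correct r ρ is o b eqs safe o<b
  compile-correct (μ↓ below f↓) =
    μ-evaluates (λ k k<y → proj₁ (below k k<y) , compile-correct (proj₂ (below k k<y)))
                (compile-correct f↓)

  prec-correct : ∀ {n} {g : Rec n} {h : Rec (2 + n)} {k xs y} → prec g h [ k ∷ xs ]↓ y →
                 Evaluates (prec g h) (k ∷ xs) y
  prec-correct r ρ (n ∷ is) o b eqs safe@((n<b , n≢o) ∷ _) o<b =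
    let ρ′ , eq-b , eq-o , frame , finish = prec-loop r ρ n is o b eqs safe o<b ≤-refl
    in ρ′ , finish (stop (trans eq-b (sym (trans (frame n n<b n≢o) (proj₁ (∷-injective eqs))))))
     , eq-o , frame

  -- A derivation for `prec` ends with the last iteration, a run of `until` begins with the first.
  -- Therefore the claim after k iterations is that every completion of the loop from there yields a
  -- run of the whole program. The bound x in register `i` stays fixed while k varies in the
  -- induction.
  prec-loop : ∀ {n} {g : Rec n} {h : Rec (2 + n)} {k x xs y} → prec g h [ k ∷ xs ]↓ y →
    ∀ ρ i (is : Vec ℕ n) o b → Vec.map ρ (i ∷ is) ≡ x ∷ xs → VecAll.All (Safe b o) (i ∷ is) → o < b →
    k ≤ x →
    ∃ λ ρ′ → ρ′ b ≡ k × ρ′ o ≡ y × (∀ i → i < b → i ≢ o → ρ′ i ≡ ρ i) ×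
      (∀ {ρ″} →
        until b i (compile h (b ∷ o ∷ is) (1 + b) (2 + b) ⨾ copy (1 + b) o ⨾ incr b) ⊢ ρ′ ⇒ ρ″ →
        compile (prec g h) (i ∷ is) o b ⊢ ρ ⇒ ρ″)
  prec-loop (prec↓-zero g↓) ρ i is o b eqs (_ ∷ safe) o<b _ =
    let ρ₁ , run , eq , frame =
          compile-correct g↓ ρ is o b (proj₂ (∷-injective eqs)) safe o<b
    in _ , ≔-same ρ₁ b 0 , trans (≔-other ρ₁ b 0 (<⇒≢ o<b)) eq
     , (λ j j<b j≢o → trans (≔-other ρ₁ b 0 (<⇒≢ j<b)) (frame j j<b j≢o))
     , λ rest → (run ⨾ clear) ⨾ rest
  prec-loop (prec↓-suc {k = k} r↓ h↓) ρ i is o b eqs safe′@((i<b , i≢o) ∷ safe) o<b k<x =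
    let b≢o = λ b≡o → <⇒≢ o<b (sym b≡o)
        ρ₁ , eq-b , eq-o , frame , finish = prec-loop r↓ ρ i is o b eqs safe′ o<b (<⇒≤ k<x)
        eqs₁ = preserved frame safe′ eqs
        ρ₂ , run₂ , eq₂ , frame₂ =
          compile-correct h↓ ρ₁ (b ∷ o ∷ is) (1 + b) (2 + b)
            (cong₂ _∷_ eq-b (cong₂ _∷_ eq-o (proj₂ (∷-injective eqs₁))))
            ((m<n⇒m<1+n ≤-refl , <⇒≢ ≤-refl) ∷
             (m<n⇒m<1+n (m<n⇒m<1+n o<b) , <⇒≢ (m<n⇒m<1+n o<b)) ∷ scratch safe)
            ≤-refl
        ρ₃ , run₃ , eq₃ , frame₃ = copy-correct {1 + b} {o} (λ e → <⇒≢ (m<n⇒m<1+n o<b) (sym e)) ρ₂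
        eq-b₃ = trans (frame₃ b b≢o) (trans (frame₂ b (m<n⇒m<1+n ≤-refl) (<⇒≢ ≤-refl)) eq-b)
    in _ , trans (≔-same ρ₃ b _) (cong suc eq-b₃)
     , trans (≔-other ρ₃ b _ (<⇒≢ o<b)) (trans eq₃ eq₂)
     , (λ j j<b j≢o → trans (≔-other ρ₃ b _ (<⇒≢ j<b)) (trans (frame₃ j j≢o)
         (trans (frame₂ j (m<n⇒m<1+n (m<n⇒m<1+n j<b)) (<⇒≢ (m<n⇒m<1+n j<b))) (frame j j<b j≢o))))
     , λ rest → finish (again
         (λ e → <⇒≢ k<x (trans (sym eq-b) (trans e (proj₁ (∷-injective eqs₁)))))
         (run₂ ⨾ run₃ ⨾ incr) rest)

  compileAll-correct : ∀ {m n} {gs : Vec (Rec n) m} {xs ys} → gs [ xs ]⇓ ys →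
    ∀ ρ is o b → Vec.map ρ is ≡ xs → VecAll.All (_< o) is → m + o ≤ b →
    ∃ λ ρ′ → compileAll gs is o b ⊢ ρ ⇒ ρ′ × Vec.map ρ′ (range o m) ≡ ys ×
             (∀ i → i < o → ρ′ i ≡ ρ i)
  compileAll-correct [] ρ is o b _ _ o≤b =
    _ , clear , refl , λ i i<o → ≔-other ρ b 0 (<⇒≢ (<-≤-trans i<o o≤b))
  compileAll-correct {suc m} (g↓ ∷ gs↓) ρ is o b eqs is<o bound =
    let o<b = ≤-trans (s≤s (m≤n+m o m)) bound
        safe = VecAll.map (λ i<o → <-trans i<o o<b , <⇒≢ i<o) is<o
        ρ₁ , run₁ , eq₁ , frame₁ = compile-correct g↓ ρ is o b eqs safe o<b
        ρ₂ , run₂ , eqs₂ , frame₂ =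
          compileAll-correct gs↓ ρ₁ is (suc o) b (preserved frame₁ safe eqs)
            (VecAll.map m<n⇒m<1+n is<o) (≤-trans (≤-reflexive (+-suc m o)) bound)
    in ρ₂ , run₁ ⨾ run₂ , cong₂ _∷_ (trans (frame₂ o ≤-refl) eq₁) eqs₂
     , λ i i<o → trans (frame₂ i (m<n⇒m<1+n i<o)) (frame₁ i (<-trans i<o o<b) (<⇒≢ i<o))

-- Flow charts: nothing is the exit position

Position : Command → Set
Position (clear _)     = ⊤
Position (incr _)      = ⊤
Position (a ⨾ b)       = Position a ⊎ Position b
Position (until _ _ a) = Maybe (Position a)

entry : ∀ a → Position a
entry (clear _)     = tt
entry (incr _)      = tt
entry (a ⨾ b)       = inj₁ (entry a)
entry (until _ _ _) = nothing

data Action (P : Set) : Set where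
  clear incr : ℕ → P → Action P
  branch     : ℕ → ℕ → P → P → Action P

mapAction : ∀ {P Q : Set} → (P → Q) → Action P → Action Q
mapAction f (clear r t)      = clear r (f t)
mapAction f (incr r t)       = incr r (f t)
mapAction f (branch m n t u) = branch m n (f t) (f u)

left : ∀ a b → Maybe (Position a) → Maybe (Position (a ⨾ b))
left a b (just p) = just (inj₁ p)
left a b nothing  = just (inj₂ (entry b))

right : ∀ a b → Maybe (Position b) → Maybe (Position (a ⨾ b))
right a b = Maybe.map inj₂

action : ∀ a → Position a → Action (Maybe (Position a))
action (clear r)     _        = clear r nothing
action (incr r)      _        = incr r nothing
action (a ⨾ b)       (inj₁ p) = mapAction (left a b) (action a p)
action (a ⨾ b)       (inj₂ p) = mapAction (right a b) (action b p)
action (until m n a) nothing  = branch m n nothing (just (just (entry a)))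
action (until m n a) (just p) = mapAction just (action a p)

perform : ∀ {P : Set} → Action P → Store → P × Store
perform (clear r t)      ρ = t , ρ [ r ≔ 0 ]
perform (incr r t)       ρ = t , ρ [ r ≔ suc (ρ r) ]
perform (branch m n t u) ρ with ρ m ≟ ρ n
... | yes _ = t , ρ
... | no  _ = u , ρ

perform-map : ∀ {P Q : Set} (f : P → Q) α ρ →
              perform (mapAction f α) ρ ≡ (f (proj₁ (perform α ρ)) , proj₂ (perform α ρ))
perform-map f (clear r t)      ρ = refl
perform-map f (incr r t)       ρ = refl
perform-map f (branch m n t u) ρ with ρ m ≟ ρ n
... | yes _ = refl
... | no  _ = refl

State : Command → Set
State a = Maybe (Position a) × Store

step : ∀ a → State a → State a
step a (just p , ρ)  = perform (action a p) ρ
step a (nothing , ρ) = nothing , ρ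

infixr 5 _◅◅_
data Run a : State a → State a → Set where
  done : ∀ {s} → Run a s s
  move : ∀ {p ρ s s′} → step a (just p , ρ) ≡ s → Run a s s′ → Run a (just p , ρ) s′

_◅◅_ : ∀ {a s s′ s″} → Run a s s′ → Run a s′ s″ → Run a s s″
done     ◅◅ r′ = r′
move e r ◅◅ r′ = move e (r ◅◅ r′)

-- Covers all three ways in which a flow chart sits inside a larger one: left or right of `⨾`, and
-- as the body of `until`. The map `f` also says where the exit of the part leads.
lift-run : ∀ {a b} (f : Maybe (Position a) → Maybe (Position b)) (g : Position a → Position b) →
           (∀ p → f (just p) ≡ just (g p)) → (∀ p → action b (g p) ≡ mapAction f (action a p)) →
           ∀ {s s′} → Run a s s′ → Run b (f (proj₁ s) , proj₂ s) (f (proj₁ s′) , proj₂ s′)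
lift-run f g fg acts done = done
lift-run {a} {b} f g fg acts {just p , ρ} {s′} (move refl r) =
  subst (λ x → Run b (x , ρ) (f (proj₁ s′) , proj₂ s′)) (sym (fg p))
    (move (trans (cong (λ α → perform α ρ) (acts p)) (perform-map f (action a p) ρ))
          (lift-run f g fg acts r))

run-left : ∀ {a b s s′} → Run a s s′ →
           Run (a ⨾ b) (left a b (proj₁ s) , proj₂ s) (left a b (proj₁ s′) , proj₂ s′)
run-left = lift-run _ inj₁ (λ _ → refl) (λ _ → refl)

run-right : ∀ {a b s s′} → Run b s s′ →
            Run (a ⨾ b) (right a b (proj₁ s) , proj₂ s) (right a b (proj₁ s′) , proj₂ s′)
run-right = lift-run _ inj₂ (λ _ → refl) (λ _ → refl)

simulate : ∀ {a ρ ρ′} → a ⊢ ρ ⇒ ρ′ → Run a (just (entry a) , ρ) (nothing , ρ′)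
simulate clear   = move refl done
simulate incr    = move refl done
simulate (x ⨾ y) = run-left (simulate x) ◅◅ run-right (simulate y)
simulate (stop {m} {n} {a} {ρ} e) = move exit done
  where
  exit : step (until m n a) (just nothing , ρ) ≡ (nothing , ρ)
  exit with ρ m ≟ ρ n
  ... | yes _ = refl
  ... | no ne = contradiction e ne
simulate (again {m} {n} {a} {ρ} ne x y) =
  move enter (lift-run just just (λ _ → refl) (λ _ → refl) (simulate x) ◅◅ simulate y)
  where
  enter : step (until m n a) (just nothing , ρ) ≡ (just (just (entry a)) , ρ)
  enter with ρ m ≟ ρ n
  ... | yes e = contradiction e ne
  ... | no _  = refl

-- Machines with guarded rules

data Update : Set where
  keep bump reset : Update

update : Update → ℕ → ℕ
update keep  x = x
update bump  x = suc x
update reset x = 0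

data Test : Set where
  equal above : ℕ → ℕ → Test

Passes : Test → Store → Set
Passes (equal m n) v = v m ≡ v n
Passes (above m n) v = v n < v m

record Rule : Set where
  constructor rule
  field
    flag    : ℕ
    test    : Test
    updates : ℕ → Update

open Rule public

Fires : Rule → Store → Set
Fires R v = v (flag R) ≢ 0 × Passes (test R) v

Follows : Rule → Store → Store → Set
Follows R v v′ = ∀ g → v′ g ≡ update (updates R g) (v g)

record Machine : Set where
  constructor machine
  field
    rules            : List Rule
    input start goal : ℕ

open Machine public

-- A flag only has to be nonzero. Giving the start flag the value k lets `startF` copy the input
-- register instead of defining a further constant.
initial : Machine → ℕ → Store
initial M k g with g ≟ input M | g ≟ start M
... | yes _ | _     = k
... | no _  | yes _ = k
... | no _  | no _  = 0

-- Every firing rule must be obeyed because the sentence asserts all rules. `growth` is what makes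
-- the encoding sequences nonincreasing.
record Reaches (M : Machine) (k : ℕ) : Set where
  field
    time    : ℕ
    history : ℕ → Store
    begins  : ∀ g → history 0 g ≡ initial M k g
    obeys   : ∀ t → t < time → ∀ {R} → R ∈ rules M →
              Fires R (history t) → Follows R (history t) (history (suc t))
    growth  : ∀ t → t < time → ∀ g → history (suc t) g ≤ suc (history t g)
    reached : history time (goal M) ≢ 0

-- One firing rule per step is enough to force the next parts in any satisfying assignment. The
-- history is endless since `q` may have any height.
record Avoids (M : Machine) (k : ℕ) : Set where
  field
    history : ℕ → Store
    begins  : ∀ g → history 0 g ≡ initial M k g
    obeys   : ∀ t → ∃ λ R → R ∈ rules M × Fires R (history t) ×
                            Follows R (history t) (history (suc t))
    avoided : ∀ t → history t (goal M) ≡ 0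

-- Even registers hold data, odd registers mark the current position.

dat flg : ℕ → ℕ
dat zero    = 0
dat (suc i) = 2 + dat i
flg zero    = 1
flg (suc i) = 2 + flg i

kind : ℕ → ℕ ⊎ ℕ
kind zero          = inj₁ 0
kind (suc zero)    = inj₂ 0
kind (suc (suc g)) = Sum.map suc suc (kind g)

kind-dat : ∀ i → kind (dat i) ≡ inj₁ i
kind-dat zero    = refl
kind-dat (suc i) = cong (Sum.map suc suc) (kind-dat i)

kind-flg : ∀ i → kind (flg i) ≡ inj₂ i
kind-flg zero    = refl
kind-flg (suc i) = cong (Sum.map suc suc) (kind-flg i)

kind-inverse : ∀ g → Sum.[ dat , flg ] (kind g) ≡ g
kind-inverse zero          = refl
kind-inverse (suc zero)    = refl
kind-inverse (suc (suc g)) with kind g | kind-inverse g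
... | inj₁ i | e = cong (2 +_) e
... | inj₂ i | e = cong (2 +_) e

-- From flow charts to machines with guarded rules

label : ∀ a → Position a → ℕ
label (clear _)     _        = 0
label (incr _)      _        = 0
-- `dat` and `flg` serve here merely as injections onto the even and the odd numbers.
label (a ⨾ b)       (inj₁ p) = dat (label a p)
label (a ⨾ b)       (inj₂ p) = flg (label b p)
label (until _ _ a) nothing  = 0
label (until _ _ a) (just p) = suc (label a p)

label-injective : ∀ a {p p′} → label a p ≡ label a p′ → p ≡ p′
label-injective (clear _) e = refl
label-injective (incr _)  e = refl
label-injective (a ⨾ b) {inj₁ p} {inj₁ p′} e =
  cong inj₁ (label-injective a (inj₁-injective
    (trans (sym (kind-dat _)) (trans (cong kind e) (kind-dat _)))))
label-injective (a ⨾ b) {inj₂ p} {inj₂ p′} e =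
  cong inj₂ (label-injective b (inj₂-injective
    (trans (sym (kind-flg _)) (trans (cong kind e) (kind-flg _)))))
label-injective (a ⨾ b) {inj₁ p} {inj₂ p′} e
  with () ← trans (sym (kind-dat (label a p))) (trans (cong kind e) (kind-flg (label b p′)))
label-injective (a ⨾ b) {inj₂ p} {inj₁ p′} e
  with () ← trans (sym (kind-flg (label b p))) (trans (cong kind e) (kind-dat (label a p′)))
label-injective (until _ _ a) {nothing} {nothing} e = refl
label-injective (until _ _ a) {just p}  {just p′} e =
  cong just (label-injective a (suc-injective e))

label? : ∀ a → Maybe (Position a) → ℕ
label? a nothing  = 0
label? a (just p) = suc (label a p)

label?-injective : ∀ a {p p′} → label? a p ≡ label? a p′ → p ≡ p′
label?-injective a {nothing} {nothing} e = refl
label?-injective a {just p}  {just p′} e = cong just (label-injective a (suc-injective e))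

positions : ∀ a → List (Position a)
positions (clear _)     = tt ∷ []
positions (incr _)      = tt ∷ []
positions (a ⨾ b)       = List.map inj₁ (positions a) List.++ List.map inj₂ (positions b)
positions (until _ _ a) = nothing ∷ List.map just (positions a)

∈-positions : ∀ a p → p ∈ positions a
∈-positions (clear _)     _        = here refl
∈-positions (incr _)      _        = here refl
∈-positions (a ⨾ b)       (inj₁ p) = ∈-++⁺ˡ (∈-map⁺ inj₁ (∈-positions a p))
∈-positions (a ⨾ b)       (inj₂ p) =
  ∈-++⁺ʳ (List.map inj₁ (positions a)) (∈-map⁺ inj₂ (∈-positions b p))
∈-positions (until _ _ a) nothing  = here refl
∈-positions (until _ _ a) (just p) = there (∈-map⁺ just (∈-positions a p))

change : ∀ {P : Set} → Action P → ℕ → Update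
change (clear r _) i with i ≟ r
... | yes _ = reset
... | no  _ = keep
change (incr r _) i with i ≟ r
... | yes _ = bump
... | no  _ = keep
change (branch _ _ _ _) i = keep

-- The updates cannot assign a positive constant, so the new position is marked by an increment; its
-- size is irrelevant.
mark : ℕ → ℕ → Update
mark l l′ with l′ ≟ l
... | yes _ = bump
... | no  _ = reset

module Flow (a : Command) where

  goto : Action (Maybe (Position a)) → Maybe (Position a) → ℕ → Update
  goto α t g = Sum.[ change α , mark (label? a t) ] (kind g)

  at : Position a → Test → Maybe (Position a) → Rule
  at p T t = rule (flg (label? a (just p))) T (goto (action a p) t)

  -- The test `equal 0 0` always passes. Inequality is not a test of its own and splits into two
  -- rules with the same target.
  rulesAt : ∀ p → Action (Maybe (Position a)) → List Rule
  rulesAt p (clear _ t)      = at p (equal 0 0) t ∷ []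
  rulesAt p (incr _ t)       = at p (equal 0 0) t ∷ []
  rulesAt p (branch m n t u) = at p (equal (dat m) (dat n)) t ∷
                               at p (above (dat m) (dat n)) u ∷
                               at p (above (dat n) (dat m)) u ∷ []

  flow : Machine
  flow = machine (concatMap (λ p → rulesAt p (action a p)) (positions a))
                 (dat 0) (flg (label? a (just (entry a)))) (flg (label? a nothing))

  states : State a → ℕ → State a
  states s zero    = s
  states s (suc t) = step a (states s t)

  states-shift : ∀ s t → states (step a s) t ≡ step a (states s t)
  states-shift s zero    = refl
  states-shift s (suc t) = cong (step a) (states-shift s t)

  run-time : ∀ {s s′} → Run a s s′ → ∃ λ t → states s t ≡ s′
  run-time done = 0 , refl
  run-time (move {p} {ρ} refl r) =
    let t , e = run-time r in suc t , trans (sym (states-shift (just p , ρ) t)) e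

  Live : State a → Set
  Live s = ∀ t → ∃ λ p → proj₁ (states s t) ≡ just p

  run-live : ∀ {s s′} → Run a s s′ → Live s′ → Live s
  run-live done     live = live
  run-live (move refl r) live zero    = _ , refl
  run-live (move {p} {ρ} refl r) live (suc t) =
    let q , e = run-live r live t
    in q , trans (cong proj₁ (sym (states-shift (just p , ρ) t))) e

  perform-change : ∀ (α : Action (Maybe (Position a))) ρ i →
                   proj₂ (perform α ρ) i ≡ update (change α i) (ρ i)
  perform-change (clear r t) ρ i with i ≟ r
  ... | yes _ = refl
  ... | no  _ = refl
  perform-change (incr r t) ρ i with i ≟ r
  ... | yes refl = refl
  ... | no  _    = refl
  perform-change (branch m n t u) ρ i with ρ m ≟ ρ n
  ... | yes _ = refl
  ... | no  _ = refl

  update-growth : ∀ u x → update u x ≤ suc x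
  update-growth keep  x = n≤1+n x
  update-growth bump  x = ≤-refl
  update-growth reset x = z≤n

  -- Determinism: rules of one position whose tests pass agree on the target. This is what `obeys`
  -- in `Reaches` rests on.
  chosen : ∀ p α ρ {v R} → (∀ i → v (dat i) ≡ ρ i) → R ∈ rulesAt p α →
           Passes (test R) v → R ≡ at p (test R) (proj₁ (perform α ρ))
  chosen p (clear r t)      ρ eq (here refl) _ = refl
  chosen p (incr r t)       ρ eq (here refl) _ = refl
  chosen p (branch m n t u) ρ eq R∈ passes with ρ m ≟ ρ n
  chosen p (branch m n t u) ρ eq (here refl) passes | yes e = refl
  chosen p (branch m n t u) ρ eq (there (here refl)) passes | yes e =
    contradiction (trans (eq n) (trans (sym e) (sym (eq m)))) (<⇒≢ passes)
  chosen p (branch m n t u) ρ eq (there (there (here refl))) passes | yes e =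
    contradiction (trans (eq m) (trans e (sym (eq n)))) (<⇒≢ passes)
  chosen p (branch m n t u) ρ eq (here refl) passes | no ¬e =
    contradiction (trans (sym (eq m)) (trans passes (eq n))) ¬e
  chosen p (branch m n t u) ρ eq (there (here refl)) passes | no ¬e = refl
  chosen p (branch m n t u) ρ eq (there (there (here refl))) passes | no ¬e = refl

  flag-at : ∀ p α {R} → R ∈ rulesAt p α → flag R ≡ flg (label? a (just p))
  flag-at p (clear r t)      (here refl)                 = refl
  flag-at p (incr r t)       (here refl)                 = refl
  flag-at p (branch m n t u) (here refl)                 = refl
  flag-at p (branch m n t u) (there (here refl))         = refl
  flag-at p (branch m n t u) (there (there (here refl))) = refl

  -- Progress, by trichotomy at a branch. This is what `obeys` in `Avoids` rests on.
  available : ∀ p α ρ {v} → (∀ i → v (dat i) ≡ ρ i) →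
              ∃ λ T → at p T (proj₁ (perform α ρ)) ∈ rulesAt p α × Passes T v
  available p (clear r t)      ρ eq = _ , here refl , refl
  available p (incr r t)       ρ eq = _ , here refl , refl
  available p (branch m n t u) ρ {v} eq with ρ m ≟ ρ n
  ... | yes e = _ , here refl , trans (eq m) (trans e (sym (eq n)))
  ... | no ¬e with <-cmp (ρ n) (ρ m)
  ...   | tri< lt _ _ = _ , there (here refl) , subst₂ _<_ (sym (eq n)) (sym (eq m)) lt
  ...   | tri≈ _ e _  = contradiction (sym e) ¬e
  ...   | tri> _ _ gt = _ , there (there (here refl)) , subst₂ _<_ (sym (eq m)) (sym (eq n)) gt

  module History (k : ℕ) where

    states₀ : ℕ → State a
    states₀ = states (just (entry a) , λ i → initial flow k (dat i))

    place : ℕ → Maybe (Position a)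
    place t = proj₁ (states₀ t)

    marks : ℕ → Store
    marks zero    l = initial flow k (flg l)
    marks (suc t) l = update (mark (label? a (place (suc t))) l) (marks t l)

    history : ℕ → Store
    history t g = Sum.[ proj₂ (states₀ t) , marks t ] (kind g)

    history-dat : ∀ t i → history t (dat i) ≡ proj₂ (states₀ t) i
    history-dat t i = cong Sum.[ _ , _ ] (kind-dat i)

    history-flg : ∀ t l → history t (flg l) ≡ marks t l
    history-flg t l = cong Sum.[ _ , _ ] (kind-flg l)

    history-begins : ∀ g → history 0 g ≡ initial flow k g
    history-begins g with kind g | kind-inverse g
    ... | inj₁ i | e = cong (initial flow k) e
    ... | inj₂ l | e = cong (initial flow k) e

    follows : ∀ t {p T} → place t ≡ just p →
              Follows (at p T (place (suc t))) (history t) (history (suc t))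
    follows t {p} e g with states₀ t
    follows t {p} refl g | just p , ρ with kind g
    ... | inj₁ i = perform-change (action a p) ρ i
    ... | inj₂ l = refl

    grows : ∀ t g → history (suc t) g ≤ suc (history t g)
    grows t g with kind g
    ... | inj₂ l = update-growth (mark (label? a (place (suc t))) l) (marks t l)
    ... | inj₁ i with states₀ t
    ...   | nothing , ρ = n≤1+n (ρ i)
    ...   | just p , ρ  = ≤-trans (≤-reflexive (perform-change (action a p) ρ i))
                                  (update-growth (change (action a p) i) (ρ i))

    marks-at : k ≢ 0 → ∀ t → marks t (label? a (place t)) ≢ 0
    marks-at k≢0 zero e = k≢0 (trans (sym (initial-start flow k)) e)
      where
      initial-start : ∀ M k → initial M k (start M) ≡ k
      initial-start M k with start M ≟ input M | start M ≟ start M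
      ... | yes _ | _      = refl
      ... | no _  | yes _  = refl
      ... | no _  | no ¬e  = contradiction refl ¬e
    marks-at k≢0 (suc t) e with label? a (place (suc t)) ≟ label? a (place (suc t))
    ... | yes _ with () ← e
    ... | no ¬e = ¬e refl

    marks-only : ∀ t l → marks t l ≢ 0 → l ≡ label? a (place t)
    marks-only zero l ≢0 with flg l ≟ dat 0 | flg l ≟ flg (label? a (just (entry a)))
    ... | yes e | _     with () ← trans (sym (kind-flg l)) (cong kind e)
    ... | no _  | yes e = inj₂-injective (trans (sym (kind-flg l)) (trans (cong kind e) (kind-flg _)))
    ... | no _  | no _  = contradiction refl ≢0
    marks-only (suc t) l ≢0 with l ≟ label? a (place (suc t))
    ... | yes e = e
    ... | no _  = contradiction refl ≢0

    place-next : ∀ t {p} → place t ≡ just p →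
                 place (suc t) ≡ proj₁ (perform (action a p) (proj₂ (states₀ t)))
    place-next t e with states₀ t
    place-next t refl | just p , ρ = refl

    history-obeys : ∀ t {R} → R ∈ rules flow → Fires R (history t) →
                    Follows R (history t) (history (suc t))
    history-obeys t {R} R∈ (flagged , passes)
      with find (∈-concatMap⁻ (λ p → rulesAt p (action a p)) {xs = positions a} R∈)
    ... | p , _ , R∈p =
      subst (λ R → Follows R (history t) (history (suc t))) (sym R≡)
        (follows t {T = test R} here-p)
      where
      flagged′ : marks t (label? a (just p)) ≢ 0
      flagged′ e = flagged (trans (cong (history t) (flag-at p (action a p) R∈p))
                                  (trans (history-flg t _) e))

      here-p : place t ≡ just p
      here-p = sym (label?-injective a (marks-only t _ flagged′))

      R≡ : R ≡ at p (test R) (place (suc t))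
      R≡ = trans (chosen p (action a p) _ (history-dat t) R∈p passes)
                 (cong (at p (test R)) (sym (place-next t here-p)))

    history-moves : k ≢ 0 → ∀ t {p} → place t ≡ just p →
                    ∃ λ R → R ∈ rules flow × Fires R (history t) ×
                            Follows R (history t) (history (suc t))
    history-moves k≢0 t {p} e =
      let T , R∈ , passes = available p (action a p) _ (history-dat t)
      in at p T (place (suc t))
       , ∈-concatMap⁺ (λ p → rulesAt p (action a p))
           (lose (∈-positions a p)
             (subst (λ u → at p T u ∈ rulesAt p (action a p)) (sym (place-next t e)) R∈))
       , ((λ e₀ → marks-at k≢0 t (trans (cong (λ u → marks t (label? a u)) e)
                                        (trans (sym (history-flg t _)) e₀))) , passes)
       , follows t {T = T} e

    initial-data : Store
    initial-data i = initial flow k (dat i)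

    reaches : k ≢ 0 → ∀ {ρ} → a ⊢ initial-data ⇒ ρ → Reaches flow k
    reaches k≢0 {ρ} r =
      let T , e = run-time (simulate r) in record
        { time    = T
        ; history = history
        ; begins  = history-begins
        ; obeys   = λ t _ → history-obeys t
        ; growth  = λ t _ → grows t
        ; reached = λ e₀ → marks-at k≢0 T
            (trans (cong (λ s → marks T (label? a (proj₁ s))) e) (trans (sym (history-flg T _)) e₀))
        }

    avoids : k ≢ 0 → Live (just (entry a) , initial-data) → Avoids flow k
    avoids k≢0 live = record
      { history = history
      ; begins  = history-begins
      ; obeys   = λ t → history-moves k≢0 t (proj₂ (live t))
      ; avoided = λ t → trans (history-flg t _) (never t)
      }
      where
      never : ∀ t → marks t 0 ≡ 0
      never t with marks t 0 in e
      ... | zero  = refl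
      ... | suc _ with () ← trans (marks-only t 0 (λ e₀ → 1+n≢0 (trans (sym e) e₀)))
                                  (cong (label? a) (proj₂ (live t)))

-- The final loop is endless unless register 1 is 0.
accepting : Rec 1 → Command
accepting f = (compile f (0 ∷ []) 1 3 ⨾ clear 2) ⨾ until 1 2 (clear 2)

accept-machine : Rec 1 → Machine
accept-machine f = Flow.flow (accepting f)

module _ (f : Rec 1) (k : ℕ) (k≢0 : k ≢ 0) where

  open Flow (accepting f)
  open History k

  evaluated : ∀ {y} → f [ k ∷ [] ]↓ y → ∃ λ ρ →
              compile f (0 ∷ []) 1 3 ⨾ clear 2 ⊢ initial-data ⇒ ρ × ρ 1 ≡ y × ρ 2 ≡ 0
  evaluated f↓ =
    let ρ , run , eq , _ = compile-correct f↓ initial-data (0 ∷ []) 1 3 refl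
                             ((s≤s z≤n , λ ()) ∷ []) (s≤s (s≤s z≤n))
    in _ , run ⨾ clear , trans (≔-other ρ 2 0 λ ()) eq , ≔-same ρ 2 0

  zero⇒reaches : f [ k ∷ [] ]↓ 0 → Reaches (accept-machine f) k
  zero⇒reaches f↓ =
    let ρ , run , eq₁ , eq₂ = evaluated f↓
    in reaches k≢0 (run ⨾ stop (trans eq₁ (sym eq₂)))

  one⇒avoids : f [ k ∷ [] ]↓ 1 → Avoids (accept-machine f) k
  one⇒avoids f↓ =
    let ρ , run , eq₁ , eq₂ = evaluated f↓
    in avoids k≢0 (run-live (run-left (simulate run)) (loop ρ eq₁ eq₂))
    where
    -- Both positions of the final loop belong to the invariant; its body clears a register that is
    -- already 0, so the two compared registers stay different.
    data Looping : State (accepting f) → Set where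
      looping : ∀ p {ρ} → ρ 1 ≡ 1 → ρ 2 ≡ 0 → Looping (just (inj₂ p) , ρ)

    looping-place : ∀ {s} → Looping s → ∃ λ p → proj₁ s ≡ just p
    looping-place (looping p _ _) = inj₂ p , refl

    loop-step : ∀ {s} → Looping s → Looping (step (accepting f) s)
    loop-step (looping nothing {ρ} eq₁ eq₂) with ρ 1 ≟ ρ 2
    ... | yes e = contradiction (trans (sym eq₁) (trans e eq₂)) λ ()
    ... | no _  = looping (just tt) eq₁ eq₂
    loop-step (looping (just tt) {ρ} eq₁ eq₂) =
      looping nothing (trans (≔-other ρ 2 0 λ ()) eq₁) (≔-same ρ 2 0)

    loop-states : ∀ {s} → Looping s → ∀ t → Looping (states s t)
    loop-states l zero    = l
    loop-states l (suc t) = loop-step (loop-states l t)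

    loop : ∀ ρ → ρ 1 ≡ 1 → ρ 2 ≡ 0 → Live (just (inj₂ nothing) , ρ)
    loop ρ eq₁ eq₂ t = looping-place (loop-states (looping nothing {ρ} eq₁ eq₂) t)

-- Partitions as decreasing sequences

nth : List ℕ → ℕ → ℕ
nth []       _       = 0
nth (x ∷ xs) zero    = x
nth (x ∷ xs) (suc i) = nth xs i

infix 8 _!_
_!_ : Partition → ℕ → ℕ
p ! i = nth (parts p) i

≤ʸ⇒! : ∀ {p q} → p ≤ʸ q → ∀ i → p ! i ≤ q ! i
≤ʸ⇒! {p} {q} (l , h) = go (parts p) (parts q) l h
  where
  go : ∀ xs ys (l : length xs ≤ length ys) →
       (∀ i → List.lookup xs i ≤ List.lookup ys (inject≤ i l)) → ∀ i → nth xs i ≤ nth ys i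
  go []       ys       l       h i       = z≤n
  go (x ∷ xs) (y ∷ ys) (s≤s l) h zero    = h zero
  go (x ∷ xs) (y ∷ ys) (s≤s l) h (suc i) = go xs ys l (λ j → h (suc j)) i

-- The comparison of lengths comes from positivity: a part of `p` beyond the end of `q` would have
-- to be at most 0.
!⇒≤ʸ : ∀ {p q} → (∀ i → p ! i ≤ q ! i) → p ≤ʸ q
!⇒≤ʸ {p} {q} = go (parts p) (parts q) (positive p)
  where
  go : ∀ xs ys → All (0 <_) xs → (∀ i → nth xs i ≤ nth ys i) →
       Σ (length xs ≤ length ys) λ l → ∀ i → List.lookup xs i ≤ List.lookup ys (inject≤ i l)
  go []       ys       _         h = z≤n , λ ()
  go (x ∷ xs) []       (0<x ∷ _) h = contradiction (h 0) (<⇒≱ 0<x)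
  go (x ∷ xs) (y ∷ ys) (_ ∷ pos) h =
    let l , h′ = go xs ys pos (λ i → h (suc i))
    in s≤s l , λ where zero → h 0 ; (suc i) → h′ i

Decreasing : (ℕ → ℕ) → Set
Decreasing f = ∀ i → f (suc i) ≤ f i

!-decreasing : ∀ p → Decreasing (p !_)
!-decreasing p = go (nonincreasing p)
  where
  go : ∀ {xs} → Linked _≥_ xs → Decreasing (nth xs)
  go []      i       = z≤n
  go [-]     i       = z≤n
  go (r ∷ l) zero    = r
  go (r ∷ l) (suc i) = go l i

antitone : ∀ {f} → Decreasing f → ∀ {i j} → i ≤ j → f j ≤ f i
antitone f↓ {zero}  {zero}  _         = ≤-refl
antitone f↓ {zero}  {suc j} _         = ≤-trans (f↓ j) (antitone f↓ {0} {j} z≤n)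
antitone f↓ {suc i} {suc j} (s≤s i≤j) = antitone (λ n → f↓ (suc n)) i≤j

!-antitone : ∀ p {i j} → i ≤ j → p ! j ≤ p ! i
!-antitone p = antitone (!-decreasing p)

height : Partition → ℕ
height p = length (parts p)

height⇒! : ∀ p {i} → i < height p → 0 < p ! i
height⇒! p = go (positive p)
  where
  go : ∀ {xs i} → All (0 <_) xs → i < length xs → 0 < nth xs i
  go {i = zero}  (0<x ∷ _) _       = 0<x
  go {i = suc i} (_ ∷ pos) (s≤s l) = go pos l

!⇒height : ∀ p {i} → 0 < p ! i → i < height p
!⇒height p = go (parts p)
  where
  go : ∀ xs {i} → 0 < nth xs i → i < length xs
  go (x ∷ xs) {zero}  _ = s≤s z≤n
  go (x ∷ xs) {suc i} h = s≤s (go xs h)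

private
  build : ℕ → (ℕ → ℕ) → List ℕ
  build zero    f = []
  build (suc N) f with f 0
  ... | zero  = []
  ... | suc x = suc x ∷ build N (λ i → f (suc i))

  build-positive : ∀ N f → All (0 <_) (build N f)
  build-positive zero    f = []
  build-positive (suc N) f with f 0
  ... | zero  = []
  ... | suc x = s≤s z≤n ∷ build-positive N _

  build-nonincreasing : ∀ N f → Decreasing f → Linked _≥_ (build N f)
  build-nonincreasing zero    f f↓ = []
  build-nonincreasing (suc N) f f↓ with f 0 | f↓ 0
  ... | zero  | _ = []
  ... | suc x | h = cons N (λ i → f (suc i)) h (build-nonincreasing N _ (λ i → f↓ (suc i)))
    where
    cons : ∀ N g {x} → g 0 ≤ x → Linked _≥_ (build N g) → Linked _≥_ (x ∷ build N g)
    cons zero    g _ l = [-]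
    cons (suc N) g h l with g 0
    ... | zero  = [-]
    ... | suc _ = h ∷ l

  -- Cutting off at the first zero loses nothing, as a decreasing function stays 0 from there on.
  nth-build : ∀ N f → Decreasing f → f N ≡ 0 → ∀ i → nth (build N f) i ≡ f i
  nth-build zero    f f↓ f0 i = sym (n≤0⇒n≡0 (≤-trans (antitone f↓ {0} {i} z≤n) (≤-reflexive f0)))
  nth-build (suc N) f f↓ fN i with f 0 in eq
  nth-build (suc N) f f↓ fN i       | zero  =
    sym (n≤0⇒n≡0 (≤-trans (antitone f↓ {0} {i} z≤n) (≤-reflexive eq)))
  nth-build (suc N) f f↓ fN zero    | suc x = sym eq
  nth-build (suc N) f f↓ fN (suc i) | suc x = nth-build N _ (λ i → f↓ (suc i)) fN i

fromFunction : ∀ N f → Decreasing f → Partition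
fromFunction N f f↓ = partition (build N f) (build-nonincreasing N f f↓) (build-positive N f)

fromFunction-! : ∀ N f (f↓ : Decreasing f) → f N ≡ 0 → ∀ i → fromFunction N f f↓ ! i ≡ f i
fromFunction-! = nth-build

rect : ℕ → ℕ → ℕ → ℕ
rect w zero    _       = 0
rect w (suc h) zero    = w
rect w (suc h) (suc i) = rect w h i

rect-decreasing : ∀ w h → Decreasing (rect w h)
rect-decreasing w zero          i       = z≤n
rect-decreasing w (suc zero)    zero    = z≤n
rect-decreasing w (suc (suc h)) zero    = ≤-refl
rect-decreasing w (suc h)       (suc i) = rect-decreasing w h i

rect-outside : ∀ w h → rect w h h ≡ 0
rect-outside w zero    = refl
rect-outside w (suc h) = rect-outside w h

rect-inside : ∀ w h → rect w (suc h) h ≡ w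
rect-inside w zero    = refl
rect-inside w (suc h) = rect-inside w h

rect-width : ∀ w h i → rect w h i ≤ w
rect-width w zero    i       = z≤n
rect-width w (suc h) zero    = ≤-refl
rect-width w (suc h) (suc i) = rect-width w h i

rect-below : ∀ w h i → i < h → rect w h i ≡ w
rect-below w (suc h) zero    _       = refl
rect-below w (suc h) (suc i) (s≤s l) = rect-below w h i l

rect-above : ∀ w h i → h ≤ i → rect w h i ≡ 0
rect-above w zero    i       _       = refl
rect-above w (suc h) (suc i) (s≤s l) = rect-above w h i l

Rectangle : ℕ → ℕ → Partition
Rectangle w h = fromFunction h (rect w h) (rect-decreasing w h)

Rectangle-! : ∀ w h i → Rectangle w h ! i ≡ rect w h i
Rectangle-! w h = fromFunction-! h (rect w h) (rect-decreasing w h) (rect-outside w h)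

-- Containment of a rectangle of height t + 1 reads off the part with index t.
Probe : Partition → ℕ → ℕ → Set
Probe x w t = ∀ p → (x ≤ʸ p → w ≤ p ! t) × (w ≤ p ! t → x ≤ʸ p)

probe : ∀ {x w t} → (∀ i → x ! i ≡ rect w (suc t) i) → Probe x w t
probe {x} {w} {t} eq p =
  (λ x≤p → ≤-trans (≤-reflexive (sym (trans (eq t) (rect-inside w t)))) (≤ʸ⇒! {x} {p} x≤p t)) ,
  (λ w≤ → !⇒≤ʸ {x} {p} λ i → ≤-trans (≤-reflexive (eq i)) (bound w≤ i))
  where
  bound : w ≤ p ! t → ∀ i → rect w (suc t) i ≤ p ! i
  bound w≤ i with ≤-total i t
  ... | inj₁ i≤t = ≤-trans (rect-width w (suc t) i) (≤-trans w≤ (!-antitone p i≤t))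
  ... | inj₂ t≤i with m≤n⇒m<n∨m≡n t≤i
  ...   | inj₁ t<i  = ≤-trans (≤-reflexive (rect-above w (suc t) i t<i)) z≤n
  ...   | inj₂ refl = ≤-trans (rect-width w (suc t) i) w≤

Rectangle-probe : ∀ w t → Probe (Rectangle w (suc t)) w t
Rectangle-probe w t = probe {Rectangle w (suc t)} (Rectangle-! w (suc t))

-- Rows, columns and rectangles

-- The constant is the rectangle of width 1 and height 2, so it detects whether there is a second
-- part.
corner-probe : Probe [1]+[1] 1 1
corner-probe = probe {[1]+[1]} λ where
  zero          → refl
  (suc zero)    → refl
  (suc (suc i)) → refl

row⇒ : ∀ {x} → ¬ [1]+[1] ≤ʸ x → x ! 1 ≡ 0
row⇒ {x} row = n≤0⇒n≡0 (≮⇒≥ λ 0<x₁ → row (proj₂ (corner-probe x) 0<x₁))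

⇒row : ∀ {x} → x ! 1 ≡ 0 → ¬ [1]+[1] ≤ʸ x
⇒row {x} x₁≡0 c≤x = <⇒≢ (proj₁ (corner-probe x) c≤x) (sym x₁≡0)

row-≤ : ∀ {x y} → x ! 1 ≡ 0 → x ! 0 ≤ y ! 0 → x ≤ʸ y
row-≤ {x} {y} x₁≡0 x₀≤y₀ = !⇒≤ʸ {x} {y} λ where
  zero    → x₀≤y₀
  (suc i) → ≤-trans (!-antitone x {1} {suc i} (s≤s z≤n)) (≤-trans (≤-reflexive x₁≡0) z≤n)

-- A column is a partition that does not contain d = (2).
module Columns {d : Partition} (d₀ : d ! 0 ≡ 2) (d₁ : d ! 1 ≡ 0) where

  column⇒ : ∀ {x} → ¬ d ≤ʸ x → x ! 0 ≤ 1
  column⇒ {x} col = ≮⇒≥ λ 2≤x₀ → col (row-≤ {d} {x} d₁ (≤-trans (≤-reflexive d₀) 2≤x₀))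

  ⇒column : ∀ {x} → x ! 0 ≤ 1 → ¬ d ≤ʸ x
  ⇒column {x} x₀≤1 d≤x =
    <⇒≱ (s≤s (s≤s z≤n)) (≤-trans (≤-trans (≤-reflexive (sym d₀)) (≤ʸ⇒! {d} {x} d≤x 0)) x₀≤1)

column-≤ : ∀ {x y} → x ! 0 ≤ 1 → height x ≤ height y → x ≤ʸ y
column-≤ {x} {y} x₀≤1 h≤h = !⇒≤ʸ {x} {y} λ i → bound i (x ! i) refl
  where
  bound : ∀ i n → x ! i ≡ n → x ! i ≤ y ! i
  bound i zero    eq = ≤-trans (≤-reflexive eq) z≤n
  bound i (suc n) eq =
    ≤-trans (≤-trans (!-antitone x {0} {i} z≤n) x₀≤1)
            (height⇒! y (≤-trans (!⇒height x (≤-trans (s≤s z≤n) (≤-reflexive (sym eq)))) h≤h))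

height-≤ : ∀ {x y} → x ≤ʸ y → height x ≤ height y
height-≤ = proj₁

height≡ : ∀ {x h} → (∀ {i} → i < h → 0 < x ! i) → x ! h ≡ 0 → height x ≡ h
height≡ {x} {h} inside outside = ≤-antisym
  (≮⇒≥ λ h< → <⇒≢ (height⇒! x h<) (sym outside))
  (≮⇒≥ λ <h → <-irrefl refl (!⇒height x (inside <h)))

Rectangle-height : ∀ w h → height (Rectangle (suc w) h) ≡ h
Rectangle-height w h = height≡ {Rectangle (suc w) h}
  (λ {i} i<h → ≤-trans (s≤s z≤n)
     (≤-reflexive (sym (trans (Rectangle-! (suc w) h i) (rect-below (suc w) h i i<h)))))
  (trans (Rectangle-! (suc w) h h) (rect-outside (suc w) h))

row : ℕ → Partition
row n = Rectangle n 1

column : ℕ → Partition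
column h = Rectangle 1 h

row-! : ∀ n → row n ! 0 ≡ n
row-! n = Rectangle-! n 1 0

row-!₁ : ∀ n → row n ! 1 ≡ 0
row-!₁ n = Rectangle-! n 1 1

column-! : ∀ h → column h ! 0 ≤ 1
column-! h = ≤-trans (≤-reflexive (Rectangle-! 1 h 0)) (rect-width 1 h 0)

-- x′ is the successor of x in the chain K, as far as z can tell.
NextAt : (Partition → Set) → Partition → Partition → Partition → Set
NextAt K z x x′ = x ≤ʸ x′ × ¬ x′ ≤ʸ x × K x′ × (K z → ¬ z ≤ʸ x → x′ ≤ʸ z)

-- r is the largest partition containing neither a nor b, as far as z can tell.
GridAt : Partition → Partition → Partition → Partition → Set
GridAt z a b r = ¬ a ≤ʸ r × ¬ b ≤ʸ r × (¬ a ≤ʸ z → ¬ b ≤ʸ z → z ≤ʸ r)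

IsRow : Partition → Set
IsRow x = ¬ [1]+[1] ≤ʸ x

-- The decisive instance of `z` is the row one longer than the first part of `x`: minimality puts
-- `x′` below it.
next-row⇒ : ∀ {x x′} → (∀ z → NextAt IsRow z x x′) → x′ ! 0 ≡ suc (x ! 0)
next-row⇒ {x} {x′} next = ≤-antisym upper
  (≰⇒> λ x′₀≤x₀ → x′≰x (row-≤ {x′} {x} (row⇒ {x′} x′-row) x′₀≤x₀))
  where
  x′≰x = proj₁ (proj₂ (next x))
  x′-row = proj₁ (proj₂ (proj₂ (next x)))
  z = row (suc (x ! 0))
  upper : x′ ! 0 ≤ suc (x ! 0)
  upper = ≤-trans (≤ʸ⇒! {x′} {z} (proj₂ (proj₂ (proj₂ (next z))) (⇒row {z} (row-!₁ (suc (x ! 0))))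
    (λ z≤x → <⇒≱ ≤-refl (≤-trans (≤-reflexive (sym (row-! (suc (x ! 0))))) (≤ʸ⇒! {z} {x} z≤x 0)))) 0)
    (≤-reflexive (row-! (suc (x ! 0))))

next-row : ∀ n z → NextAt IsRow z (row n) (row (suc n))
next-row n z =
    row-≤ {row n} {row (suc n)} (row-!₁ n) (subst₂ _≤_ (sym (row-! n)) (sym (row-! (suc n))) (n≤1+n n))
  , (λ h → <⇒≱ ≤-refl (subst₂ _≤_ (row-! (suc n)) (row-! n) (≤ʸ⇒! {row (suc n)} {row n} h 0)))
  , ⇒row {row (suc n)} (row-!₁ (suc n))
  , λ z-row z≰ → row-≤ {row (suc n)} {z} (row-!₁ (suc n)) (≤-trans (≤-reflexive (row-! (suc n)))
      (≰⇒> λ z₀≤n → z≰ (row-≤ {z} {row n} (row⇒ {z} z-row) (≤-trans z₀≤n (≤-reflexive (sym (row-! n)))))))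

module _ {d : Partition} (d₀ : d ! 0 ≡ 2) (d₁ : d ! 1 ≡ 0) where

  open Columns {d} d₀ d₁

  IsColumn : Partition → Set
  IsColumn x = ¬ d ≤ʸ x

  next-column⇒ : ∀ {x x′} → (∀ z → NextAt IsColumn z x x′) → height x′ ≡ suc (height x)
  next-column⇒ {x} {x′} next =
    ≤-antisym upper (≰⇒> λ h → x′≰x (column-≤ {x′} {x} (column⇒ {x′} x′-column) h))
    where
    x′≰x = proj₁ (proj₂ (next x))
    x′-column = proj₁ (proj₂ (proj₂ (next x)))
    h = height x
    z = column (suc h)
    upper : height x′ ≤ suc h
    upper = ≤-trans (proj₁ (proj₂ (proj₂ (proj₂ (next z))) (⇒column {z} (column-! (suc h)))
      (λ z≤x → <⇒≱ ≤-refl (≤-trans (≤-reflexive (sym (Rectangle-height 0 (suc h)))) (proj₁ z≤x)))))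
      (≤-reflexive (Rectangle-height 0 (suc h)))

  next-column : ∀ n z → NextAt IsColumn z (column n) (column (suc n))
  next-column n z =
      column-≤ {column n} {column (suc n)} (column-! n)
        (subst₂ _≤_ (sym (Rectangle-height 0 n)) (sym (Rectangle-height 0 (suc n))) (n≤1+n n))
    , (λ h → <⇒≱ ≤-refl (subst₂ _≤_ (Rectangle-height 0 (suc n)) (Rectangle-height 0 n) (proj₁ h)))
    , ⇒column {column (suc n)} (column-! (suc n))
    , λ z-col z≰ → column-≤ {column (suc n)} {z} (column-! (suc n))
        (≤-trans (≤-reflexive (Rectangle-height 0 (suc n)))
          (≰⇒> λ h → z≰ (column-≤ {z} {column n} (column⇒ {z} z-col)
                            (≤-trans h (≤-reflexive (sym (Rectangle-height 0 n)))))))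

-- For a row a of length w + 1 and a column b of height h + 1 the partition
-- described by GridAt is the rectangle of width w and height h.
module _ {a b : Partition} {w h : ℕ} (a₁ : a ! 1 ≡ 0) (a₀ : a ! 0 ≡ suc w)
         (b₀ : b ! 0 ≤ 1) (b-height : height b ≡ suc h) where

  avoid-row : ∀ x → x ! 0 ≤ w → ¬ a ≤ʸ x
  avoid-row x x₀≤w a≤x = <⇒≱ (s≤s x₀≤w) (≤-trans (≤-reflexive (sym a₀)) (≤ʸ⇒! {a} {x} a≤x 0))

  avoid-column : ∀ x → x ! h ≡ 0 → ¬ b ≤ʸ x
  avoid-column x xₕ≡0 b≤x =
    <⇒≢ (height⇒! x (≤-trans (≤-reflexive (sym b-height)) (height-≤ {b} {x} b≤x))) (sym xₕ≡0)

  avoiding-row : ∀ x → ¬ a ≤ʸ x → x ! 0 ≤ w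
  avoiding-row x a≰x = ≮⇒≥ λ w<x₀ → a≰x (row-≤ {a} {x} a₁ (≤-trans (≤-reflexive a₀) w<x₀))

  avoiding-column : ∀ x → ¬ b ≤ʸ x → x ! h ≡ 0
  avoiding-column x b≰x = n≤0⇒n≡0 (≮⇒≥ λ 0<xₕ →
    b≰x (column-≤ {b} {x} b₀ (≤-trans (≤-reflexive b-height) (!⇒height x 0<xₕ))))

  inside : ∀ x → x ! 0 ≤ w → x ! h ≡ 0 → ∀ i → x ! i ≤ rect w h i
  inside x x₀≤w xₕ≡0 i with <-≤-connex i h
  ... | inj₁ i<h = ≤-trans (≤-trans (!-antitone x {0} {i} z≤n) x₀≤w)
                           (≤-reflexive (sym (rect-below w h i i<h)))
  ... | inj₂ h≤i = ≤-trans (!-antitone x h≤i) (≤-trans (≤-reflexive xₕ≡0) z≤n)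

  private R = Rectangle w h

  R₀ : R ! 0 ≤ w
  R₀ = ≤-trans (≤-reflexive (Rectangle-! w h 0)) (rect-width w h 0)

  Rₕ : R ! h ≡ 0
  Rₕ = trans (Rectangle-! w h h) (rect-outside w h)

  grid : ∀ z → GridAt z a b R
  grid z = avoid-row R R₀ , avoid-column R Rₕ , λ a≰z b≰z → !⇒≤ʸ {z} {R} λ i →
    ≤-trans (inside z (avoiding-row z a≰z) (avoiding-column z b≰z) i)
            (≤-reflexive (sym (Rectangle-! w h i)))

  grid⇒ : ∀ {r} → (∀ z → GridAt z a b r) → ∀ i → r ! i ≡ rect w h i
  grid⇒ {r} g i = ≤-antisym
    (inside r (avoiding-row r (proj₁ (g R))) (avoiding-column r (proj₁ (proj₂ (g R)))) i)
    (≤-trans (≤-reflexive (sym (Rectangle-! w h i)))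
      (≤ʸ⇒! {R} {r} (proj₂ (proj₂ (g R)) (avoid-row R R₀) (avoid-column R Rₕ)) i))

-- Formulas

-- Matrices with named variables. An assignment τ of term codes to the names
-- turns them into quantifier-free formulas.

infix  8 _⊑_
infix  7 ∼_
infixr 6 _∧_
infixr 5 _⇒_
data Matrix (V : Set) : Set where
  _⊑_     : V → V → Matrix V
  ∼_      : Matrix V → Matrix V
  _∧_ _⇒_ : Matrix V → Matrix V → Matrix V

-- A code in range does not depend on the number n of variables in scope, so neither does the code
-- of a matrix. Codes out of range become `c`, in accordance with the default value of `env`.
term : ∀ n → ℕ → Term n
term n       zero          = c
term zero    (suc i)       = c
term (suc n) (suc zero)    = var zero
term (suc n) (suc (suc i)) = weaken (term n (suc i))
  where
  weaken : ∀ {n} → Term n → Term (suc n)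
  weaken (var i) = var (suc i)
  weaken c       = c

toFormula : ∀ {V} n → (V → ℕ) → Matrix V → Formula n
toFormula n τ (a ⊑ b) = term n (τ a) ≼ term n (τ b)
toFormula n τ (∼ φ)   = ¬′ toFormula n τ φ
toFormula n τ (φ ∧ ψ) = toFormula n τ φ ∧′ toFormula n τ ψ
toFormula n τ (φ ⇒ ψ) = toFormula n τ φ ⇒′ toFormula n τ ψ

toFormula-quantifierFree : ∀ {V} n (τ : V → ℕ) φ → QuantifierFree (toFormula n τ φ)
toFormula-quantifierFree n τ (a ⊑ b) = _ ≼ _
toFormula-quantifierFree n τ (∼ φ)   = ¬′ toFormula-quantifierFree n τ φ
toFormula-quantifierFree n τ (φ ∧ ψ) = toFormula-quantifierFree n τ φ ∧′ toFormula-quantifierFree n τ ψ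
toFormula-quantifierFree n τ (φ ⇒ ψ) = toFormula-quantifierFree n τ φ ⇒′ toFormula-quantifierFree n τ ψ

code : ∀ {V} → (V → ℕ) → Matrix V → ℕ
code τ (a ⊑ b) = pair 0 (pair (τ a) (τ b))
code τ (∼ φ)   = pair 2 (code τ φ)
code τ (φ ∧ ψ) = pair 3 (pair (code τ φ) (code τ ψ))
code τ (φ ⇒ ψ) = pair 5 (pair (code τ φ) (code τ ψ))

Every : ∀ {V : Set} → (V → Set) → Matrix V → Set
Every P (a ⊑ b) = P a × P b
Every P (∼ φ)   = Every P φ
Every P (φ ∧ ψ) = Every P φ × Every P ψ
Every P (φ ⇒ ψ) = Every P φ × Every P ψ

Every-map : ∀ {V} {P Q : V → Set} → (∀ v → P v → Q v) → ∀ φ → Every P φ → Every Q φ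
Every-map f (a ⊑ b) (p , q) = f a p , f b q
Every-map f (∼ φ)   e       = Every-map f φ e
Every-map f (φ ∧ ψ) (p , q) = Every-map f φ p , Every-map f ψ q
Every-map f (φ ⇒ ψ) (p , q) = Every-map f φ p , Every-map f ψ q

triangle-≥ : ∀ n → n ≤ triangle n
triangle-≥ zero    = z≤n
triangle-≥ (suc n) = m≤n+m (suc n) (triangle n)

pair-≥ʳ : ∀ a b → b ≤ pair a b
pair-≥ʳ a b = m≤n+m b (triangle (a + b))

pair-≥ˡ : ∀ a b → a ≤ pair a b
pair-≥ˡ a b = ≤-trans (m≤m+n a b) (≤-trans (triangle-≥ (a + b)) (m≤m+n _ b))

names-≤-code : ∀ {V} (τ : V → ℕ) φ → Every (λ v → τ v ≤ code τ φ) φ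
names-≤-code τ (a ⊑ b) =
    ≤-trans (pair-≥ˡ (τ a) (τ b)) (pair-≥ʳ 0 (pair (τ a) (τ b)))
  , ≤-trans (pair-≥ʳ (τ a) (τ b)) (pair-≥ʳ 0 (pair (τ a) (τ b)))
names-≤-code τ (∼ φ) = Every-map (λ v h → ≤-trans h (pair-≥ʳ 2 _)) φ (names-≤-code τ φ)
names-≤-code τ (φ ∧ ψ) =
    Every-map (λ v h → ≤-trans h (≤-trans (pair-≥ˡ _ (code τ ψ)) (pair-≥ʳ 3 _))) φ (names-≤-code τ φ)
  , Every-map (λ v h → ≤-trans h (≤-trans (pair-≥ʳ (code τ φ) _) (pair-≥ʳ 3 _))) ψ (names-≤-code τ ψ)
names-≤-code τ (φ ⇒ ψ) =
    Every-map (λ v h → ≤-trans h (≤-trans (pair-≥ˡ _ (code τ ψ)) (pair-≥ʳ 5 _))) φ (names-≤-code τ φ)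
  , Every-map (λ v h → ≤-trans h (≤-trans (pair-≥ʳ (code τ φ) _) (pair-≥ʳ 5 _))) ψ (names-≤-code τ ψ)

⌜term⌝ : ∀ n i → i ≤ n → ⌜ term n i ⌝ᵗ ≡ i
⌜term⌝ n       zero          _       = refl
⌜term⌝ (suc n) (suc zero)    _       = refl
⌜term⌝ (suc n) (suc (suc i)) (s≤s h) with term n (suc i) | ⌜term⌝ n (suc i) h
... | var j | e = cong suc e

⌜toFormula⌝ : ∀ {V} n (τ : V → ℕ) φ → Every (λ v → τ v ≤ n) φ → ⌜ toFormula n τ φ ⌝ ≡ code τ φ
⌜toFormula⌝ n τ (a ⊑ b) (p , q) =
  cong₂ (λ x y → pair 0 (pair x y)) (⌜term⌝ n (τ a) p) (⌜term⌝ n (τ b) q)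
⌜toFormula⌝ n τ (∼ φ)   e       = cong (pair 2) (⌜toFormula⌝ n τ φ e)
⌜toFormula⌝ n τ (φ ∧ ψ) (p , q) =
  cong₂ (λ x y → pair 3 (pair x y)) (⌜toFormula⌝ n τ φ p) (⌜toFormula⌝ n τ ψ q)
⌜toFormula⌝ n τ (φ ⇒ ψ) (p , q) =
  cong₂ (λ x y → pair 5 (pair x y)) (⌜toFormula⌝ n τ φ p) (⌜toFormula⌝ n τ ψ q)

nthOr : ∀ {n} → Vec Partition n → ℕ → Partition
nthOr []      _       = [1]+[1]
nthOr (p ∷ ρ) zero    = p
nthOr (p ∷ ρ) (suc i) = nthOr ρ i

-- The value of a term from its code; variables out of range denote [1]+[1].
env : ∀ {n} → Vec Partition n → ℕ → Partition
env ρ zero    = [1]+[1]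
env ρ (suc i) = nthOr ρ i

value-term : ∀ {n} (ρ : Vec Partition n) i → value ρ (term n i) ≡ env ρ i
value-term ρ       zero          = refl
value-term []      (suc i)       = refl
value-term (p ∷ ρ) (suc zero)    = refl
value-term {suc n} (p ∷ ρ) (suc (suc i)) with term n (suc i) | value-term ρ (suc i)
... | var j | e = e
... | c     | e = e

⟦_⟧ : ∀ {V : Set} → Matrix V → (V → Partition) → Set
⟦ a ⊑ b ⟧ σ = σ a ≤ʸ σ b
⟦ ∼ φ ⟧   σ = ¬ ⟦ φ ⟧ σ
⟦ φ ∧ ψ ⟧ σ = ⟦ φ ⟧ σ × ⟦ ψ ⟧ σ
⟦ φ ⇒ ψ ⟧ σ = ⟦ φ ⟧ σ → ⟦ ψ ⟧ σ

⟦⟧? : ∀ {V : Set} (φ : Matrix V) σ → Dec (⟦ φ ⟧ σ)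
⟦⟧? (a ⊑ b) σ = σ a ≤ʸ? σ b
⟦⟧? (∼ φ)   σ = ¬? (⟦⟧? φ σ)
⟦⟧? (φ ∧ ψ) σ = ⟦⟧? φ σ ×-dec ⟦⟧? ψ σ
⟦⟧? (φ ⇒ ψ) σ = ⟦⟧? φ σ →-dec ⟦⟧? ψ σ

⊨-toFormula : ∀ {V n} (ρ : Vec Partition n) (τ : V → ℕ) φ →
              (ρ ⊨ toFormula n τ φ) ≡ ⟦ φ ⟧ (env ρ ∘ τ)
⊨-toFormula ρ τ (a ⊑ b) = cong₂ _≤ʸ_ (value-term ρ (τ a)) (value-term ρ (τ b))
⊨-toFormula ρ τ (∼ φ)   = cong ¬_ (⊨-toFormula ρ τ φ)
⊨-toFormula ρ τ (φ ∧ ψ) = cong₂ _×_ (⊨-toFormula ρ τ φ) (⊨-toFormula ρ τ ψ)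
⊨-toFormula ρ τ (φ ⇒ ψ) = cong₂ (λ A B → A → B) (⊨-toFormula ρ τ φ) (⊨-toFormula ρ τ ψ)

⟦⟧-cong : ∀ {V : Set} {σ σ′ : V → Partition} φ → Every (λ v → σ v ≡ σ′ v) φ → ⟦ φ ⟧ σ ≡ ⟦ φ ⟧ σ′
⟦⟧-cong (a ⊑ b) (p , q) = cong₂ _≤ʸ_ p q
⟦⟧-cong (∼ φ)   e       = cong ¬_ (⟦⟧-cong φ e)
⟦⟧-cong (φ ∧ ψ) (p , q) = cong₂ _×_ (⟦⟧-cong φ p) (⟦⟧-cong ψ q)
⟦⟧-cong (φ ⇒ ψ) (p , q) = cong₂ (λ A B → A → B) (⟦⟧-cong φ p) (⟦⟧-cong ψ q)

-- The empty conjunction is written `v ⊑ v`, since matrices have no symbol for truth.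
⋀ : ∀ {V A : Set} → V → List A → (A → Matrix V) → Matrix V
⋀ v []       f = v ⊑ v
⋀ v (x ∷ xs) f = f x ∧ ⋀ v xs f

prefix : Quantifier → ∀ k {n} → Formula (k + n) → Formula n
prefix Q zero    φ = φ
prefix Q (suc k) φ = prefix Q k (quant Q φ)

close : ∀ n → Formula n → Sentence
close zero    φ = φ
close (suc n) φ = close n (quant ex φ)

prefix-all⇒ : ∀ k {n} {ρ : Vec Partition n} {φ} → ρ ⊨ prefix all k φ →
              ∀ (ps : Vec Partition k) → (ps ++ ρ) ⊨ φ
prefix-all⇒ zero    h []       = h
prefix-all⇒ (suc k) h (p ∷ ps) = prefix-all⇒ k h ps p

⇒prefix-all : ∀ k {n} {ρ : Vec Partition n} {φ} →
              (∀ (ps : Vec Partition k) → (ps ++ ρ) ⊨ φ) → ρ ⊨ prefix all k φ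
⇒prefix-all zero    h = h []
⇒prefix-all (suc k) h = ⇒prefix-all k λ ps p → h (p ∷ ps)

close⇒ : ∀ n {φ} → [] ⊨ close n φ → DoubleNegation (∃ λ ρ → ρ ⊨ φ)
close⇒ zero    h k = k ([] , h)
close⇒ (suc n) h k = close⇒ n h λ (ρ , h′) → h′ λ (p , h″) → k (p ∷ ρ , h″)

⇒close : ∀ n {φ} → ∃ (λ ρ → ρ ⊨ φ) → [] ⊨ close n φ
⇒close zero    ([] , h)    = h
⇒close (suc n) (p ∷ ρ , h) = ⇒close n (ρ , λ k → k (p , h))

prefix-prenex : ∀ k {n m} {φ : Formula (suc k + n)} → Prenex ex m φ →
                Prenex all (suc m) (prefix all (suc k) φ)
prefix-prenex k {n} p = go k (new p)
  where
  go : ∀ k {n m} {φ : Formula (k + n)} → Prenex all (suc m) φ → Prenex all (suc m) (prefix all k φ)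
  go zero    p = p
  go (suc k) p = go k (extend p)

close-prenex : ∀ n {m} {φ : Formula (suc n)} → Prenex all m φ → Prenex ex (suc m) (close (suc n) φ)
close-prenex n p = go n (new p)
  where
  go : ∀ n {m} {φ : Formula n} → Prenex ex (suc m) φ → Prenex ex (suc m) (close n φ)
  go zero    p = p
  go (suc n) p = go n (extend p)

-- Codes of quantifier prefixes and of long conjunctions

times : (ℕ → ℕ) → ℕ → ℕ → ℕ
times f zero    x = x
times f (suc n) x = f (times f n x)

times-shift : ∀ f n x → times f n (f x) ≡ f (times f n x)
times-shift f zero    x = refl
times-shift f (suc n) x = cong f (times-shift f n x)

⌜prefix⌝ : ∀ k {n} (φ : Formula (k + n)) → ⌜ prefix all k φ ⌝ ≡ times (pair 6) k ⌜ φ ⌝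
⌜prefix⌝ zero    φ = refl
⌜prefix⌝ (suc k) φ = trans (⌜prefix⌝ k (quant all φ)) (times-shift (pair 6) k ⌜ φ ⌝)

⌜close⌝ : ∀ n (φ : Formula n) → ⌜ close n φ ⌝ ≡ times (pair 7) n ⌜ φ ⌝
⌜close⌝ zero    φ = refl
⌜close⌝ (suc n) φ = trans (⌜close⌝ n (quant ex φ)) (times-shift (pair 7) n ⌜ φ ⌝)

-- The number of links varies with k; this nesting makes the code a primitive recursion on that
-- number.
conjunction : ∀ {n} → Formula n → Formula n → (ℕ → Formula n) → ℕ → Formula n
conjunction φ ψ f zero    = φ ∧′ ψ
conjunction φ ψ f (suc i) = f i ∧′ conjunction φ ψ f i

conjunction-quantifierFree : ∀ {n} {φ ψ : Formula n} {f} → QuantifierFree φ → QuantifierFree ψ →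
                             (∀ i → QuantifierFree (f i)) → ∀ i → QuantifierFree (conjunction φ ψ f i)
conjunction-quantifierFree φ ψ f zero    = φ ∧′ ψ
conjunction-quantifierFree φ ψ f (suc i) = f i ∧′ conjunction-quantifierFree φ ψ f i

conjunctionCode : ℕ → ℕ → (ℕ → ℕ) → ℕ → ℕ
conjunctionCode x z f zero    = pair 3 (pair x z)
conjunctionCode x z f (suc i) = pair 3 (pair (f i) (conjunctionCode x z f i))

⌜conjunction⌝ : ∀ {n} (φ ψ : Formula n) (f : ℕ → Formula n) {x z m} k → ⌜ φ ⌝ ≡ x → ⌜ ψ ⌝ ≡ z →
                (∀ i → i < k → ⌜ f i ⌝ ≡ m i) →
                ⌜ conjunction φ ψ f k ⌝ ≡ conjunctionCode x z m k
⌜conjunction⌝ φ ψ f zero    refl refl eqs = refl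
⌜conjunction⌝ φ ψ f (suc k) refl refl eqs =
  cong₂ (λ x z → pair 3 (pair x z)) (eqs k ≤-refl)
        (⌜conjunction⌝ φ ψ f k refl refl λ i i<k → eqs i (m<n⇒m<1+n i<k))

blockCode : ℕ → ℕ → ℕ → ℕ → ℕ
blockCode n k x z = times (pair 7) n (times (pair 6) k (pair 7 (pair 6 (pair 3 (pair x z)))))

⌜block⌝ : ∀ n k (φ ψ : Formula (suc (suc (k + n)))) {x z} → ⌜ φ ⌝ ≡ x → ⌜ ψ ⌝ ≡ z →
          ⌜ close n (prefix all k (quant ex (quant all (φ ∧′ ψ)))) ⌝ ≡ blockCode n k x z
⌜block⌝ n k φ ψ refl refl = trans (⌜close⌝ n _) (cong (times (pair 7) n) (⌜prefix⌝ k _))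

-- The variables: the constant [1]+[1], the inner existential variable, the 16
-- universal variables, and the outer existential variables 𝕕, 𝕢 and reg g.
data Name : Set where
  corner 𝕫 𝕪 𝕒₀ 𝕒₁ 𝕒₂ 𝕓₁ 𝕓₂ 𝕔₁ 𝕟₁ 𝕟₂ 𝕣 𝕣⁺ 𝕤 𝕤⁻ 𝕥 𝕥⁺ 𝕦 𝕕 𝕢 : Name
  reg : ℕ → Name

termCode : Name → ℕ
termCode corner  = 0
termCode 𝕫       = 2
termCode 𝕪       = 3
termCode 𝕒₀      = 4
termCode 𝕒₁      = 5
termCode 𝕒₂      = 6
termCode 𝕓₁      = 7
termCode 𝕓₂      = 8
termCode 𝕔₁      = 9
termCode 𝕟₁      = 10
termCode 𝕟₂      = 11
termCode 𝕣       = 12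
termCode 𝕣⁺      = 13
termCode 𝕤       = 14
termCode 𝕤⁻      = 15
termCode 𝕥       = 16
termCode 𝕥⁺      = 17
termCode 𝕦       = 18
termCode 𝕕       = 19
termCode 𝕢       = 20
termCode (reg g) = 21 + g

-- The matrix that describes a machine

rowF columnF : Name → Matrix Name
rowF x    = ∼ corner ⊑ x
columnF x = ∼ 𝕕 ⊑ x

nextF : (Name → Matrix Name) → Name → Name → Matrix Name
nextF K x x′ = x ⊑ x′ ∧ ∼ x′ ⊑ x ∧ K x′ ∧ (K 𝕫 ⇒ ∼ 𝕫 ⊑ x ⇒ x′ ⊑ 𝕫)

gridF : Name → Name → Name → Matrix Name
gridF a n x = ∼ a ⊑ x ∧ ∼ n ⊑ x ∧ (∼ a ⊑ 𝕫 ⇒ ∼ n ⊑ 𝕫 ⇒ 𝕫 ⊑ x)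

-- With 𝕟₁ of height t + 2 and 𝕒₁ of length w + 2, the rectangles 𝕣, 𝕣⁺, 𝕤, 𝕤⁻
-- have sizes (w+1)×(t+1), (w+2)×(t+1), (w+1)×(t+2), w×(t+2): they compare the
-- parts with indices t and t + 1. Further rectangles 𝕥, 𝕥⁺ and 𝕦 of height
-- t + 1 serve to evaluate the guard of a rule at time t.
layout : Matrix Name
layout =
  nextF rowF 𝕒₀ 𝕒₁ ∧ nextF rowF 𝕒₁ 𝕒₂ ∧ nextF rowF 𝕓₁ 𝕓₂ ∧ nextF columnF 𝕟₁ 𝕟₂ ∧
  rowF 𝕒₀ ∧ rowF 𝕓₁ ∧ rowF 𝕔₁ ∧ columnF 𝕟₁ ∧ corner ⊑ 𝕟₁ ∧ 𝕟₁ ⊑ 𝕢 ∧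
  gridF 𝕒₁ 𝕟₁ 𝕣 ∧ gridF 𝕒₂ 𝕟₁ 𝕣⁺ ∧ gridF 𝕒₁ 𝕟₂ 𝕤 ∧ gridF 𝕒₀ 𝕟₂ 𝕤⁻ ∧
  gridF 𝕓₁ 𝕟₁ 𝕥 ∧ gridF 𝕓₂ 𝕟₁ 𝕥⁺ ∧ gridF 𝕔₁ 𝕟₁ 𝕦

testF : Test → Matrix Name
testF (equal m n) = (𝕥 ⊑ reg m ∧ ∼ 𝕥⁺ ⊑ reg m) ∧ (𝕥 ⊑ reg n ∧ ∼ 𝕥⁺ ⊑ reg n)
testF (above m n) = 𝕥 ⊑ reg m ∧ ∼ 𝕥 ⊑ reg n

-- For `keep` and `bump` the premise pins the part with index t to w + 1. For `bump` the conclusion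
-- bounds the next part from below, and monotonicity bounds it from above. For `reset` the universal
-- w runs through all thresholds, so the next parts of `p` and `𝕢` coincide.
updateF : Update → Name → Matrix Name
updateF keep  p = 𝕣 ⊑ p ∧ ∼ 𝕣⁺ ⊑ p ⇒ 𝕤⁻ ⊑ p ∧ ∼ 𝕤 ⊑ p
updateF bump  p = 𝕣 ⊑ p ∧ ∼ 𝕣⁺ ⊑ p ⇒ 𝕤 ⊑ p
updateF reset p = (𝕤 ⊑ p ⇒ 𝕤 ⊑ 𝕢) ∧ (𝕤 ⊑ 𝕢 ⇒ 𝕤 ⊑ p)

mentioned : Test → List ℕ
mentioned (equal m n) = m ∷ n ∷ []
mentioned (above m n) = m ∷ n ∷ []

-- A rule updates infinitely many registers; the formula follows those on which guards, input and
-- goal depend.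
registers : Machine → List ℕ
registers M = input M ∷ start M ∷ goal M ∷
              List.concatMap (λ R → flag R ∷ mentioned (test R)) (rules M)

-- The guard says that the flag register exceeds the base at time t. The base itself obeys `keep`,
-- being a register with constant value 0; this makes it drop by one.
ruleF : Machine → Rule → Matrix Name
ruleF M R = (𝕦 ⊑ reg (flag R) ∧ ∼ 𝕦 ⊑ 𝕢) ∧ testF (test R) ⇒
            updateF keep 𝕢 ∧ ⋀ corner (registers M) λ g → updateF (updates R g) (reg g)

-- A row lies below a partition exactly when its length is at most the first part. With `y`
-- universal this equates the first parts of `p` and `p′`.
sameRow : ∀ {V} → V → V → V → V → Matrix V
sameRow k y p p′ = ∼ k ⊑ y ⇒ (y ⊑ p ⇒ y ⊑ p′) ∧ (y ⊑ p′ ⇒ y ⊑ p)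

startF : Machine → ℕ → Matrix Name
startF M g with g ≟ input M | g ≟ start M
... | yes _ | _     = corner ⊑ corner
... | no _  | yes _ = sameRow corner 𝕪 (reg g) (reg (input M))
... | no _  | no _  = sameRow corner 𝕪 (reg g) 𝕢

-- Pins `𝕕` down as (2), the least row not below (1,1).
twoF : Matrix Name
twoF = rowF 𝕕 ∧ ∼ 𝕕 ⊑ corner ∧ (rowF 𝕪 ⇒ ∼ 𝕪 ⊑ corner ⇒ 𝕕 ⊑ 𝕪)

-- The first conjunct makes the goal register exceed the base at some index. The second bounds its
-- height by that of `𝕢`, so that this happens where `𝕢` is positive and the encoding is under
-- control.
goalF : Machine → Matrix Name
goalF M = ∼ reg (goal M) ⊑ 𝕢 ∧ (columnF 𝕪 ⇒ 𝕪 ⊑ reg (goal M) ⇒ 𝕪 ⊑ 𝕢)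

-- `𝕫` occurs only in `layout`, so an existential `𝕫` in front of the implication amounts to a
-- universal one in front of its premise.
machineF : Machine → Matrix Name
machineF M = twoF ∧ goalF M ∧ ⋀ corner (registers M) (startF M) ∧
             (layout ⇒ ⋀ corner (rules M) (ruleF M))

-- The input k enters as a chain of k + 1 successive rows, from the first part
-- of the input register down to that of 𝕢.
data ChainName : Set where
  name : Name → ChainName
  link : ℕ → ChainName

chainCode : ℕ → ℕ → ChainName → ℕ
chainCode k i (name x) = termCode x
chainCode k i (link j) = 19 + (j + (i + k))

-- In contrast to `nextF`, minimality is asserted here and not assumed, so it is tested by `𝕪`
-- rather than `𝕫`.
linkF lastF : Matrix ChainName
linkF = ∼ name corner ⊑ link 0 ∧ link 1 ⊑ link 0 ∧ ∼ link 0 ⊑ link 1 ∧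
        (∼ name corner ⊑ name 𝕪 ⇒ ∼ name 𝕪 ⊑ link 1 ⇒ link 0 ⊑ name 𝕪)
lastF = sameRow (name corner) (name 𝕪) (link 0) (name 𝕢)

firstF : ℕ → Matrix ChainName
firstF g = sameRow (name corner) (name 𝕪) (link 0) (name (reg g))

-- There are k parameters `𝕕`, `𝕢`, `reg 0`, ... followed by k + 1 chain rows. Since k will be the
-- code of the matrix, and names are bounded by that code, k parameters suffice.
size : ℕ → ℕ
size k = k + suc k

-- The sentences and their codes

module Sentences (g : ℕ) where

  chain : ∀ n → ℕ → ℕ → Formula n
  chain n k = conjunction (toFormula n (chainCode k 0) (firstF g)) (toFormula n (chainCode k k) lastF)
                          (λ i → toFormula n (chainCode k i) linkF)

  kernel : ∀ k → Matrix Name → Formula (18 + size k)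
  kernel k φ = toFormula _ termCode φ ∧′ chain _ k k

  sentence : ℕ → Matrix Name → Sentence
  sentence k φ = close (size k) (prefix all 16 (quant ex (quant all (kernel k φ))))

  sentence-Σ₄ : ∀ k φ → Σ[ 4 ] (sentence k φ)
  -- As a successor, the size shows that the outer existential block is nonempty.
  sentence-Σ₄ k φ rewrite +-suc k k =
    close-prenex (k + k) (prefix-prenex 15 (new (new (matrix
      (toFormula-quantifierFree _ termCode φ ∧′
       conjunction-quantifierFree (toFormula-quantifierFree _ (chainCode k 0) (firstF g))
         (toFormula-quantifierFree _ (chainCode k k) lastF)
         (λ i → toFormula-quantifierFree _ (chainCode k i) linkF) k)))))

  chainCodes : ℕ → ℕ → ℕ
  chainCodes k = conjunctionCode (code (chainCode k 0) (firstF g)) (code (chainCode k k) lastF)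
                                 (λ i → code (chainCode k i) linkF)

  sentenceCode : ℕ → ℕ → ℕ
  sentenceCode k m = blockCode (size k) 16 m (chainCodes k k)

  chain-bound : ∀ k i → i ≤ k → 19 + (i + k) ≤ 18 + size k
  chain-bound k i i≤k = begin
    19 + (i + k)  ≤⟨ +-monoʳ-≤ 19 (+-monoˡ-≤ k i≤k) ⟩
    19 + (k + k)  ≡⟨ cong (18 +_) (+-suc k k) ⟨
    18 + size k   ∎
    where open ≤-Reasoning

  module _ (k : ℕ) (k-large : 21 + g ≤ k) where

    bound : ∀ i → i ≤ 21 + g → i ≤ 18 + size k
    bound i i≤ = ≤-trans i≤ (≤-trans k-large (≤-trans (m≤m+n k (suc k)) (m≤n+m (size k) 18)))

    private N = 18 + size k

    ⌜chain⌝ : ⌜ chain (18 + size k) k k ⌝ ≡ chainCodes k k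
    ⌜chain⌝ = ⌜conjunction⌝ (toFormula N (chainCode k 0) (firstF g)) (toFormula N (chainCode k k) lastF)
      (λ i → toFormula N (chainCode k i) linkF)
      {code (chainCode k 0) (firstF g)} {code (chainCode k k) lastF}
      {λ i → code (chainCode k i) linkF} k
      (⌜toFormula⌝ N (chainCode k 0) (firstF g)
        ((z≤n , y≤) , ((y≤ , l₀) , (y≤ , p≤)) , ((y≤ , p≤) , (y≤ , l₀))))
      (⌜toFormula⌝ N (chainCode k k) lastF
        ((z≤n , y≤) , ((y≤ , lₖ) , (y≤ , q≤)) , ((y≤ , q≤) , (y≤ , lₖ))))
      (λ i i<k → ⌜toFormula⌝ N (chainCode k i) linkF
        ((z≤n , chain-bound k i (<⇒≤ i<k)) , (chain-bound k (suc i) i<k , chain-bound k i (<⇒≤ i<k)) ,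
         (chain-bound k i (<⇒≤ i<k) , chain-bound k (suc i) i<k) , (z≤n , y≤) ,
         (y≤ , chain-bound k (suc i) i<k) , (chain-bound k i (<⇒≤ i<k) , y≤)))
      where
      y≤ = bound 3 (s≤s (s≤s (s≤s z≤n)))
      p≤ = bound (21 + g) ≤-refl
      q≤ = bound 20 (m≤m+n 20 (suc g))
      l₀ = chain-bound k 0 z≤n
      lₖ = chain-bound k k ≤-refl

    ⌜sentence⌝ : ∀ φ → Every (λ x → termCode x ≤ k) φ →
                 ⌜ sentence k φ ⌝ ≡ sentenceCode k (code termCode φ)
    ⌜sentence⌝ φ names = ⌜block⌝ (size k) 16 (toFormula N termCode φ) (chain N k k)
      {code termCode φ} {chainCodes k k}
      (⌜toFormula⌝ N termCode φ (Every-map (λ _ h → ≤-trans h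
          (≤-trans (m≤m+n k (suc k)) (m≤n+m (size k) 18))) φ names))
      ⌜chain⌝

-- Every sentence of an avoiding machine is false

⋀⇒ : ∀ {V A : Set} {σ : V → Partition} v (xs : List A) {f : A → Matrix V} → ⟦ ⋀ v xs f ⟧ σ →
     ∀ {x} → x ∈ xs → ⟦ f x ⟧ σ
⋀⇒ v (x ∷ xs) (h , _) (here refl) = h
⋀⇒ v (x ∷ xs) (_ , h) (there x∈)  = ⋀⇒ v xs h x∈

conjunction⇒ : ∀ {n} {ρ : Vec Partition n} {φ ψ f} k → ρ ⊨ conjunction φ ψ f k →
               (ρ ⊨ φ) × (ρ ⊨ ψ) × (∀ i → i < k → ρ ⊨ f i)
conjunction⇒ zero    (h , h′) = h , h′ , λ _ ()
conjunction⇒ {ρ = ρ} {f = f} (suc k) (h , h′) =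
  let a , b , links = conjunction⇒ k h′ in a , b , λ i i<1+k → at i (m<1+n⇒m<n∨m≡n i<1+k) links
  where
  at : ∀ i → i < k ⊎ i ≡ k → (∀ i → i < k → ρ ⊨ f i) → ρ ⊨ f i
  at i (inj₁ i<k)  links = links i i<k
  at i (inj₂ refl) links = h

flag∈ : ∀ {M R} → R ∈ rules M → flag R ∈ registers M
flag∈ R∈ = there (there (there (∈-concatMap⁺ _ (lose R∈ (here refl)))))

mentioned∈ : ∀ {M R g} → R ∈ rules M → g ∈ mentioned (test R) → g ∈ registers M
mentioned∈ R∈ g∈ = there (there (there (∈-concatMap⁺ _ (lose R∈ (there g∈)))))

-- The innermost variable, with term code 1, does not occur in a kernel.
assign : ∀ {n} → Vec Partition n → Vec Partition 16 → Partition → ℕ → Partition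
assign ρ ps z = env (z ∷ z ∷ (ps ++ ρ))

-- Outside the transition rules, `𝕪` is the one universal variable that is mentioned; the others may
-- take any value.
only : Partition → Vec Partition 16
only x = x ∷ x ∷ x ∷ x ∷ x ∷ x ∷ x ∷ x ∷ x ∷ x ∷ x ∷ x ∷ x ∷ x ∷ x ∷ x ∷ []

rectangles : (w v x t : ℕ) → Vec Partition 16
rectangles w v x t =
  [1]+[1] ∷ row (1 + w) ∷ row (2 + w) ∷ row (3 + w) ∷ row (1 + v) ∷ row (2 + v) ∷ row (1 + x) ∷
  column (2 + t) ∷ column (3 + t) ∷
  Rectangle (1 + w) (1 + t) ∷ Rectangle (2 + w) (1 + t) ∷
  Rectangle (1 + w) (2 + t) ∷ Rectangle w (2 + t) ∷
  Rectangle v (1 + t) ∷ Rectangle (1 + v) (1 + t) ∷ Rectangle x (1 + t) ∷ []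

grid-rectangle : ∀ w h z → GridAt z (row (1 + w)) (column (1 + h)) (Rectangle w h)
grid-rectangle w h = grid {row (1 + w)} {column (1 + h)} (row-!₁ (1 + w)) (row-! (1 + w))
                          (column-! (1 + h)) (Rectangle-height 0 (1 + h))

module _ {n} (ρ : Vec Partition n) (d₀ : nthOr ρ 0 ! 0 ≡ 2) (d₁ : nthOr ρ 0 ! 1 ≡ 0)  where

  open Columns {nthOr ρ 0} d₀ d₁

  -- For genuine rectangles the premise holds at every z. Hence the transition rules apply whichever
  -- z the inner existential quantifier returns.
  rectangles-layout : ∀ w v x t → 0 < nthOr ρ 1 ! (1 + t) →
                      ∀ z → ⟦ layout ⟧ (assign ρ (rectangles w v x t) z ∘ termCode)
  rectangles-layout w v x t 0<q z =
      next-row (1 + w) z , next-row (2 + w) z , next-row (1 + v) z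
    , next-column {nthOr ρ 0} d₀ d₁ (2 + t) z
    , ⇒row {row (1 + w)} (row-!₁ (1 + w)) , ⇒row {row (1 + v)} (row-!₁ (1 + v))
    , ⇒row {row (1 + x)} (row-!₁ (1 + x)) , ⇒column {column (2 + t)} (column-! (2 + t))
    , proj₂ (corner-probe (column (2 + t))) (≤-reflexive (sym (Rectangle-! 1 (2 + t) 1)))
    , proj₂ (Rectangle-probe 1 (1 + t) (nthOr ρ 1)) 0<q
    , grid-rectangle (1 + w) (1 + t) z , grid-rectangle (2 + w) (1 + t) z
    , grid-rectangle (1 + w) (2 + t) z , grid-rectangle w (2 + t) z
    , grid-rectangle v (1 + t) z , grid-rectangle (1 + v) (1 + t) z , grid-rectangle x (1 + t) z

module Soundness (M : Machine) (k : ℕ) (ρ : Vec Partition (size k))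
                 (holds : ρ ⊨ prefix all 16 (quant ex (quant all
                            (Sentences.kernel (input M) k (machineF M)))))
                 (avoids : Avoids M k) where

  open Sentences (input M)
  open Avoids avoids

  d q : Partition
  d = nthOr ρ 0
  q = nthOr ρ 1

  p chainRow : ℕ → Partition
  p g        = nthOr ρ (2 + g)
  chainRow i = nthOr ρ (i + k)

  record Facts (ps : Vec Partition 16) (z : Partition) : Set where
    field
      the-machine : ⟦ machineF M ⟧ (assign ρ ps z ∘ termCode)
      the-first   : ⟦ firstF (input M) ⟧ (assign ρ ps z ∘ chainCode k 0)
      the-last    : ⟦ lastF ⟧ (assign ρ ps z ∘ chainCode k k)
      the-links   : ∀ i → i < k → ⟦ linkF ⟧ (assign ρ ps z ∘ chainCode k i)

  open Facts

  facts : ∀ ps z → (z ∷ z ∷ (ps ++ ρ)) ⊨ kernel k (machineF M) → Facts ps z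
  facts ps z (h , h′) =
    let a , b , links = conjunction⇒ k h′ in record
      { the-machine = subst id (⊨-toFormula ρ′ termCode (machineF M)) h
      ; the-first   = subst id (⊨-toFormula ρ′ (chainCode k 0) (firstF (input M))) a
      ; the-last    = subst id (⊨-toFormula ρ′ (chainCode k k) lastF) b
      ; the-links   = λ i i<k → subst id (⊨-toFormula ρ′ (chainCode k i) linkF) (links i i<k)
      }
    where ρ′ = z ∷ z ∷ (ps ++ ρ)

  -- Instantiates the universal block. The witness for `𝕫` exists only up to double negation, hence
  -- the restriction to decidable conclusions.
  extract : ∀ ps {P : Set} → Dec P → (∀ z → Facts ps z → P) → P
  extract ps P? f = decidable-stable P? λ ¬P →
    prefix-all⇒ 16 {φ = quant ex (quant all (kernel k (machineF M)))} holds ps λ (z , h) →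
      ¬P (f z (facts ps z (h z)))

  d-is-2 : d ! 0 ≡ 2 × d ! 1 ≡ 0
  d-is-2 = extract (only (row 2)) ((d ! 0 ≟ 2) ×-dec (d ! 1 ≟ 0)) λ z fs →
    let (d-row , d≰c , least) , _ = the-machine fs
        d₁ = row⇒ {d} d-row
    in ≤-antisym
         (≤ʸ⇒! {d} {row 2} (least (⇒row {row 2} refl) λ h → <⇒≱ ≤-refl (≤ʸ⇒! {row 2} {[1]+[1]} h 0)) 0)
         (≰⇒> λ d₀≤1 → d≰c (row-≤ {d} {[1]+[1]} d₁ d₀≤1))
     , d₁

  d₀ = proj₁ d-is-2
  d₁ = proj₂ d-is-2

  open Columns {d} d₀ d₁

  same-first : ∀ {x x′} →
               (∀ y z → Facts (only y) z → IsRow y → (y ≤ʸ x → y ≤ʸ x′) × (y ≤ʸ x′ → y ≤ʸ x)) →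
               x ! 0 ≡ x′ ! 0
  same-first {x} {x′} same = ≤-antisym
    (half x x′ λ z fs → proj₁ (same _ z fs (row-row (x ! 0))))
    (half x′ x λ z fs → proj₂ (same _ z fs (row-row (x′ ! 0))))
    where
    row-row : ∀ m → IsRow (row m)
    row-row m = ⇒row {row m} (row-!₁ m)

    half : ∀ x x′ → (∀ z → Facts (only (row (x ! 0))) z → row (x ! 0) ≤ʸ x → row (x ! 0) ≤ʸ x′) →
           x ! 0 ≤ x′ ! 0
    half x x′ h = extract (only (row (x ! 0))) (x ! 0 ≤? x′ ! 0) λ z fs →
      ≤-trans (≤-reflexive (sym (row-! (x ! 0))))
        (≤ʸ⇒! {row (x ! 0)} {x′}
          (h z fs (row-≤ {row (x ! 0)} {x} (row-!₁ (x ! 0)) (≤-reflexive (row-! (x ! 0))))) 0)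

  chain-step : ∀ i → i < k → chainRow i ! 0 ≡ suc (chainRow (suc i) ! 0)
  chain-step i i<k = extract (only y) (x ! 0 ≟ suc (x′ ! 0)) λ z fs →
    let x-row , x′≤x , x≰x′ , least = the-links fs i i<k
    in ≤-antisym
         (≤-trans (≤ʸ⇒! {x} {y} (least (⇒row {y} (row-!₁ (suc (x′ ! 0))))
            (λ h → <⇒≱ ≤-refl (≤-trans (≤-reflexive (sym (row-! (suc (x′ ! 0))))) (≤ʸ⇒! {y} {x′} h 0)))) 0)
            (≤-reflexive (row-! (suc (x′ ! 0)))))
         (≰⇒> λ h → x≰x′ (row-≤ {x} {x′} (row⇒ {x} x-row) h))
    where
    x  = chainRow i
    x′ = chainRow (suc i)
    y  = row (suc (x′ ! 0))

  chain-sum : ∀ i → i ≤ k → chainRow 0 ! 0 ≡ i + chainRow i ! 0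
  chain-sum zero    _   = refl
  chain-sum (suc i) i<k = trans (chain-sum i (<⇒≤ i<k))
    (trans (cong (i +_) (chain-step i i<k)) (+-suc i (chainRow (suc i) ! 0)))

  input-first : p (input M) ! 0 ≡ q ! 0 + k
  input-first = begin
    p (input M) ! 0      ≡⟨ same-first {chainRow 0} {p (input M)} (λ y z fs → the-first fs) ⟨
    chainRow 0 ! 0       ≡⟨ chain-sum k ≤-refl ⟩
    k + chainRow k ! 0   ≡⟨ cong (k +_) (same-first {chainRow k} {q} (λ y z fs → the-last fs)) ⟩
    k + q ! 0            ≡⟨ +-comm k (q ! 0) ⟩
    q ! 0 + k            ∎
    where open ≡-Reasoning

  Encodes : ℕ → Set
  Encodes t = ∀ {g} → g ∈ registers M → p g ! t ≡ q ! t + history t g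

  start-formula : ∀ {g} → g ∈ registers M → ∀ y z → Facts (only y) z →
                  ⟦ startF M g ⟧ (assign ρ (only y) z ∘ termCode)
  start-formula g∈ y z fs = ⋀⇒ corner (registers M) (proj₁ (proj₂ (proj₂ (the-machine fs)))) g∈

  first-parts : ∀ g → g ∈ registers M → p g ! 0 ≡ q ! 0 + initial M k g
  first-parts g g∈ with start-formula g∈
  ... | start-g with g ≟ input M | g ≟ start M
  ...   | yes refl | _    = input-first
  ...   | no _     | yes _ = trans (same-first {p g} {p (input M)} start-g) input-first
  ...   | no _     | no _  = trans (same-first {p g} {q} start-g) (sym (+-identityʳ (q ! 0)))

  encodes-start : Encodes 0
  encodes-start {g} g∈ = trans (first-parts g g∈) (cong (q ! 0 +_) (sym (begins g)))

  module Step (t : ℕ) (0<q : 0 < q ! suc t) (encodes : Encodes t) (R : Rule)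
              (R∈ : R ∈ rules M) (fires : Fires R (history t)) where

    tested : Test → ℕ
    tested (equal m n) = m
    tested (above m n) = m

    -- The guard is evaluated with v = p (tested) ! t and x = p (flag R) ! t.
    grid-at : ℕ → Vec Partition 16
    grid-at w = rectangles w (p (tested (test R)) ! t) (p (flag R) ! t) t

    register-above : ∀ {g} → g ∈ registers M → history t g ≢ 0 → q ! t < p g ! t
    register-above {g} g∈ ≢0 = begin-strict
      q ! t                ≡⟨ +-identityʳ (q ! t) ⟨
      q ! t + 0            <⟨ +-monoʳ-< (q ! t) (n≢0⇒n>0 ≢0) ⟩
      q ! t + history t g  ≡⟨ encodes g∈ ⟨
      p g ! t              ∎
      where open ≤-Reasoning

    test-holds : ∀ T → (∀ {g} → g ∈ mentioned T → g ∈ registers M) → Passes T (history t) →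
                 ∀ w x z → ⟦ testF T ⟧ (assign ρ (rectangles w (p (tested T) ! t) x t) z ∘ termCode)
    test-holds (equal m n) ∈regs passes w x z = reads (p m) refl , reads (p n) eq
      where
      eq : p n ! t ≡ p m ! t
      eq = trans (encodes (∈regs (there (here refl))))
                 (trans (cong (q ! t +_) (sym passes)) (sym (encodes (∈regs (here refl)))))

      reads : ∀ x → x ! t ≡ p m ! t →
              Rectangle (p m ! t) (suc t) ≤ʸ x × ¬ Rectangle (suc (p m ! t)) (suc t) ≤ʸ x
      reads x e = proj₂ (Rectangle-probe (p m ! t) t x) (≤-reflexive (sym e))
                , λ h → <⇒≱ (s≤s (≤-reflexive e)) (proj₁ (Rectangle-probe (suc (p m ! t)) t x) h)
    test-holds (above m n) ∈regs passes w x z =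
        proj₂ (Rectangle-probe (p m ! t) t (p m)) ≤-refl
      , λ h → <⇒≱ less (proj₁ (Rectangle-probe (p m ! t) t (p n)) h)
      where
      less : p n ! t < p m ! t
      less = subst₂ _<_ (sym (encodes (∈regs (there (here refl))))) (sym (encodes (∈regs (here refl))))
                    (+-monoʳ-< (q ! t) passes)

    Updated : ℕ → Partition → ℕ → Update → Set
    Updated w z g U = ⟦ updateF U (reg g) ⟧ (assign ρ (grid-at w) z ∘ termCode)

    Effect : ℕ → Partition → Set
    Effect w z = ⟦ updateF keep 𝕢 ⟧ (assign ρ (grid-at w) z ∘ termCode) ×
                 (∀ {g} → g ∈ registers M → Updated w z g (updates R g))

    effect : ∀ w z → Facts (grid-at w) z → Effect w z
    effect w z fs =
      let keeps , updated = ⋀⇒ corner (rules M)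
            (proj₂ (proj₂ (proj₂ (the-machine fs)))
              (rectangles-layout ρ d₀ d₁ w _ (p (flag R) ! t) t 0<q z)) R∈
            (( proj₂ (Rectangle-probe (p (flag R) ! t) t (p (flag R))) ≤-refl
             , (λ h → <⇒≱ (register-above (flag∈ {M} R∈) (proj₁ fires))
                          (proj₁ (Rectangle-probe (p (flag R) ! t) t q) h)))
            , test-holds (test R) (mentioned∈ {M} R∈) (proj₂ fires) w _ z)
      in keeps , λ g∈ → ⋀⇒ corner (registers M) updated g∈

    by-effect : ∀ w {P : Set} → Dec P → (∀ z → Effect w z → P) → P
    by-effect w P? f = extract (grid-at w) P? λ z fs → f z (effect w z fs)

    reads-part : ∀ w x → x ! t ≡ suc w →
                 Rectangle (suc w) (suc t) ≤ʸ x × ¬ Rectangle (2 + w) (suc t) ≤ʸ x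
    reads-part w x e = proj₂ (Rectangle-probe (suc w) t x) (≤-reflexive (sym e))
                     , λ h → <⇒≱ (s≤s (≤-reflexive e)) (proj₁ (Rectangle-probe (2 + w) t x) h)

    at-next : ∀ w x → Rectangle w (2 + t) ≤ʸ x × ¬ Rectangle (suc w) (2 + t) ≤ʸ x → x ! suc t ≡ w
    at-next w x (h , h′) = ≤-antisym
      (≮⇒≥ λ w< → h′ (proj₂ (Rectangle-probe (suc w) (suc t) x) w<))
      (proj₁ (Rectangle-probe w (suc t) x) h)

    q-step : q ! t ≡ suc (q ! suc t)
    q-step = positive-case (q ! t) refl
      where
      positive-case : ∀ m → q ! t ≡ m → q ! t ≡ suc (q ! suc t)
      positive-case zero    e = contradiction (≤-trans 0<q (!-decreasing q t)) (<⇒≱ (s≤s (≤-reflexive e)))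
      positive-case (suc w) e = by-effect w (q ! t ≟ suc (q ! suc t)) λ z (keeps , _) →
        trans e (cong suc (sym (at-next w q (keeps (reads-part w q e)))))

    part-step : ∀ {g} → g ∈ registers M →
                p g ! suc t ≡ q ! suc t + update (updates R g) (history t g)
    part-step {g} g∈ = by-update (updates R g) refl
      where
      old : p g ! t ≡ suc (q ! suc t + history t g)
      old = trans (encodes g∈) (cong (_+ history t g) q-step)

      w = q ! suc t + history t g

      by-update : ∀ U → updates R g ≡ U → p g ! suc t ≡ q ! suc t + update U (history t g)
      by-update keep eq = by-effect w (_ ≟ _) λ z (_ , updated) →
        at-next w (p g) (subst (Updated w z g) eq (updated g∈)
                          (reads-part w (p g) old))
      by-update bump eq = by-effect w (_ ≟ _) λ z (_ , updated) →
        trans (≤-antisym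
                (≤-trans (!-decreasing (p g) t) (≤-reflexive old))
                (proj₁ (Rectangle-probe (suc w) (suc t) (p g))
                  (subst (Updated w z g) eq (updated g∈)
                         (reads-part w (p g) old))))
              (sym (+-suc (q ! suc t) (history t g)))
      by-update reset eq = trans (≤-antisym (half (p g) q proj₁) (half q (p g) proj₂))
                                 (sym (+-identityʳ (q ! suc t)))
        where
        Agree : ℕ → Set
        Agree w = (Rectangle (suc w) (2 + t) ≤ʸ p g → Rectangle (suc w) (2 + t) ≤ʸ q) ×
                  (Rectangle (suc w) (2 + t) ≤ʸ q → Rectangle (suc w) (2 + t) ≤ʸ p g)

        half : ∀ x x′ →
               (∀ {w} → Agree w → Rectangle (suc w) (2 + t) ≤ʸ x → Rectangle (suc w) (2 + t) ≤ʸ x′) →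
               x ! suc t ≤ x′ ! suc t
        half x x′ h = go (x ! suc t) ≤-refl
          where
          go : ∀ m → m ≤ x ! suc t → m ≤ x′ ! suc t
          go zero    _ = z≤n
          go (suc w) l = by-effect w (_ ≤? _) λ z (_ , updated) →
            proj₁ (Rectangle-probe (suc w) (suc t) x′)
              (h (subst (Updated w z g) eq (updated g∈))
                 (proj₂ (Rectangle-probe (suc w) (suc t) x) l))

  encodes-all : ∀ t → 0 < q ! t → Encodes t
  encodes-all zero    _   = encodes-start
  encodes-all (suc t) 0<q {g} g∈ =
    let R , R∈ , fires , follows = obeys t
    in trans (Step.part-step t 0<q (encodes-all t (≤-trans 0<q (!-decreasing q t))) R R∈ fires g∈)
             (cong (q ! suc t +_) (sym (follows g)))

  -- Where `q` is positive, the encoding is correct and the goal register is 0. Where `q` vanishes,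
  -- the column of height t + 1 in `goalF` shows that the goal partition vanishes as well.
  goal-below : ∀ t → p (goal M) ! t ≤ q ! t
  goal-below t = by-size (q ! t) refl
    where
    by-size : ∀ m → q ! t ≡ m → p (goal M) ! t ≤ q ! t
    by-size (suc m) e = ≤-reflexive (trans
      (encodes-all t (≤-trans (s≤s z≤n) (≤-reflexive (sym e))) (there (there (here refl))))
      (trans (cong (q ! t +_) (avoided t)) (+-identityʳ (q ! t))))
    by-size zero    e = ≮⇒≥ λ q<p → <⇒≱ (≤-trans (s≤s z≤n) q<p)
      (≤-trans (no-more (≤-trans (s≤s z≤n) q<p)) (≤-reflexive e))
      where
      no-more : 0 < p (goal M) ! t → p (goal M) ! t ≤ q ! t
      no-more 0<p = contradiction
        (extract (only (column (suc t))) (1 ≤? q ! t) λ z fs →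
          let _ , (_ , bounded) , _ = the-machine fs
          in proj₁ (Rectangle-probe 1 t q)
               (bounded (⇒column {column (suc t)} (column-! (suc t)))
                        (proj₂ (Rectangle-probe 1 t (p (goal M))) 0<p)))
        (<⇒≱ (s≤s (≤-reflexive e)))

  impossible : ⊥
  impossible = extract (only [1]+[1]) (no id) λ z fs →
    let _ , (goal≰q , _) , _ = the-machine fs
    in goal≰q (!⇒≤ʸ {p (goal M)} {q} goal-below)

-- Every sentence of a reaching machine is true

⇒⋀ : ∀ {V A : Set} {σ : V → Partition} v (xs : List A) {f : A → Matrix V} →
     (∀ {x} → x ∈ xs → ⟦ f x ⟧ σ) → ⟦ ⋀ v xs f ⟧ σ
⇒⋀ {σ = σ} v []       h = !⇒≤ʸ {σ v} {σ v} λ _ → ≤-refl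
⇒⋀         v (x ∷ xs) h = h (here refl) , ⇒⋀ v xs (h ∘ there)

⇒conjunction : ∀ {n} {ρ : Vec Partition n} {φ ψ f} k → ρ ⊨ φ → ρ ⊨ ψ → (∀ i → i < k → ρ ⊨ f i) →
               ρ ⊨ conjunction φ ψ f k
⇒conjunction zero    a b links = a , b
⇒conjunction (suc k) a b links =
  links k ≤-refl , ⇒conjunction k a b λ i i<k → links i (m<n⇒m<1+n i<k)

vector : ∀ n → (ℕ → Partition) → Vec Partition n
vector zero    f = []
vector (suc n) f = f 0 ∷ vector n (f ∘ suc)

nthOr-vector : ∀ n f i → i < n → nthOr (vector n f) i ≡ f i
nthOr-vector (suc n) f zero    _       = refl
nthOr-vector (suc n) f (suc i) (s≤s l) = nthOr-vector n (f ∘ suc) i l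

nthOr-++ˡ : ∀ {m n} (ρ : Vec Partition m) (ρ′ : Vec Partition n) i → i < m →
            nthOr (ρ ++ ρ′) i ≡ nthOr ρ i
nthOr-++ˡ (p ∷ ρ) ρ′ zero    _       = refl
nthOr-++ˡ (p ∷ ρ) ρ′ (suc i) (s≤s l) = nthOr-++ˡ ρ ρ′ i l

nthOr-++ʳ : ∀ {m n} (ρ : Vec Partition m) (ρ′ : Vec Partition n) i →
            nthOr (ρ ++ ρ′) (m + i) ≡ nthOr ρ′ i
nthOr-++ʳ []      ρ′ i = refl
nthOr-++ʳ (p ∷ ρ) ρ′ i = nthOr-++ʳ ρ ρ′ i

-- The partition whose part with index t is the time left, T + 1 - t, plus v t.
shape : ℕ → (ℕ → ℕ) → ℕ → ℕ
shape T v t with t ≤? T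
... | yes _ = (suc T ∸ t) + v t
... | no _  = 0

shape-before : ∀ T v {t} → t ≤ T → shape T v t ≡ suc (T ∸ t) + v t
shape-before T v {t} t≤T with t ≤? T
... | yes _ = cong (_+ v t) (+-∸-assoc 1 t≤T)
... | no ¬h = contradiction t≤T ¬h

shape-after : ∀ T v {t} → T < t → shape T v t ≡ 0
shape-after T v {t} T<t with t ≤? T
... | yes h = contradiction T<t (≤⇒≯ h)
... | no _  = refl

-- The time left loses one per step, which offsets a gain of at most one in v.
shape-decreasing : ∀ T v → (∀ t → t < T → v (suc t) ≤ suc (v t)) → Decreasing (shape T v)
shape-decreasing T v growth t with <-≤-connex t T
... | inj₂ T≤t = ≤-trans (≤-reflexive (shape-after T v (s≤s T≤t))) z≤n
... | inj₁ t<T = begin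
  shape T v (suc t)                ≡⟨ shape-before T v t<T ⟩
  suc (T ∸ suc t) + v (suc t)      ≡⟨ cong (_+ v (suc t)) (sym (+-∸-assoc 1 t<T)) ⟩
  (T ∸ t) + v (suc t)              ≤⟨ +-monoʳ-≤ (T ∸ t) (growth t t<T) ⟩
  (T ∸ t) + suc (v t)              ≡⟨ +-suc (T ∸ t) (v t) ⟩
  suc (T ∸ t) + v t                ≡⟨ shape-before T v (<⇒≤ t<T) ⟨
  shape T v t                      ∎
  where open ≤-Reasoning

-- What the hypothesis layout means, for all values of 𝕫 together.
record Reading (q r r⁺ s s⁻ x x⁺ u : Partition) : Set where
  field
    w v z t    : ℕ
    later      : 0 < q ! suc t
    r-probe    : Probe r  (suc w) t
    r⁺-probe   : Probe r⁺ (2 + w) t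
    s-probe    : Probe s  (suc w) (suc t)
    s⁻-probe   : Probe s⁻ w       (suc t)
    x-probe    : Probe x  v       t
    x⁺-probe   : Probe x⁺ (suc v) t
    u-probe    : Probe u  z       t

-- The empty partition lies below `x`, so avoiding `a` already forces a positive part.
nonempty-row : ∀ {a n x} → ¬ [1]+[1] ≤ʸ a → GridAt [1]+[1] a n x → ∃ λ w → a ! 0 ≡ suc w
nonempty-row {a} {n} {x} a-row (a≰x , _) with a ! 0 in e
... | suc w = w , refl
... | zero  = contradiction (row-≤ {a} {x} (row⇒ {a} a-row) (≤-trans (≤-reflexive e) z≤n)) a≰x

LayoutAt : (d q a₀ a₁ a₂ b₁ b₂ c₁ n₁ n₂ r r⁺ s s⁻ x x⁺ u z : Partition) → Set
LayoutAt d q a₀ a₁ a₂ b₁ b₂ c₁ n₁ n₂ r r⁺ s s⁻ x x⁺ u z =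
  NextAt IsRow z a₀ a₁ × NextAt IsRow z a₁ a₂ × NextAt IsRow z b₁ b₂ ×
  NextAt (λ x → ¬ d ≤ʸ x) z n₁ n₂ ×
  IsRow a₀ × IsRow b₁ × IsRow c₁ × ¬ d ≤ʸ n₁ × [1]+[1] ≤ʸ n₁ × n₁ ≤ʸ q ×
  GridAt z a₁ n₁ r × GridAt z a₂ n₁ r⁺ × GridAt z a₁ n₂ s × GridAt z a₀ n₂ s⁻ ×
  GridAt z b₁ n₁ x × GridAt z b₂ n₁ x⁺ × GridAt z c₁ n₁ u

reading : ∀ {d q a₀ a₁ a₂ b₁ b₂ c₁ n₁ n₂ r r⁺ s s⁻ x x⁺ u} → d ! 0 ≡ 2 → d ! 1 ≡ 0 →
  (∀ z → LayoutAt d q a₀ a₁ a₂ b₁ b₂ c₁ n₁ n₂ r r⁺ s s⁻ x x⁺ u z) → Reading q r r⁺ s s⁻ x x⁺ u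
reading {d} {q} {a₀} {a₁} {a₂} {b₁} {b₂} {c₁} {n₁} {n₂} {r} {r⁺} {s} {s⁻} {x} {x⁺} {u} d₀ d₁ h = record
  { w = w ; v = v ; z = z ; t = t
  ; later    = height⇒! q (≤-trans (≤-reflexive (sym n₁-height)) (height-≤ {n₁} {q} n₁≤q))
  ; r-probe  = probe {r}  (grid⇒ {a₁} {n₁} a₁₁ a₁₀ n₁-column n₁-height {r} g₁)
  ; r⁺-probe = probe {r⁺} (grid⇒ {a₂} {n₁} a₂₁ a₂₀ n₁-column n₁-height {r⁺} g₂)
  ; s-probe  = probe {s}  (grid⇒ {a₁} {n₂} a₁₁ a₁₀ n₂-column n₂-height {s} g₃)
  ; s⁻-probe = probe {s⁻} (grid⇒ {a₀} {n₂} a₀₁ a₀₀ n₂-column n₂-height {s⁻} g₄)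
  ; x-probe  = probe {x}  (grid⇒ {b₁} {n₁} b₁₁ b₁₀ n₁-column n₁-height {x} g₅)
  ; x⁺-probe = probe {x⁺} (grid⇒ {b₂} {n₁} b₂₁ b₂₀ n₁-column n₁-height {x⁺} g₆)
  ; u-probe  = probe {u}  (grid⇒ {c₁} {n₁} c₁₁ c₁₀ n₁-column n₁-height {u} g₇)
  }
  where
  open Columns {d} d₀ d₁

  g₁ : ∀ z → GridAt z a₁ n₁ r
  g₁ z = let (_ , _ , _ , _ , _ , _ , _ , _ , _ , _ , g , _) = h z in g
  g₂ : ∀ z → GridAt z a₂ n₁ r⁺
  g₂ z = let (_ , _ , _ , _ , _ , _ , _ , _ , _ , _ , _ , g , _) = h z in g
  g₃ : ∀ z → GridAt z a₁ n₂ s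
  g₃ z = let (_ , _ , _ , _ , _ , _ , _ , _ , _ , _ , _ , _ , g , _) = h z in g
  g₄ : ∀ z → GridAt z a₀ n₂ s⁻
  g₄ z = let (_ , _ , _ , _ , _ , _ , _ , _ , _ , _ , _ , _ , _ , g , _) = h z in g
  g₅ : ∀ z → GridAt z b₁ n₁ x
  g₅ z = let (_ , _ , _ , _ , _ , _ , _ , _ , _ , _ , _ , _ , _ , _ , g , _) = h z in g
  g₆ : ∀ z → GridAt z b₂ n₁ x⁺
  g₆ z = let (_ , _ , _ , _ , _ , _ , _ , _ , _ , _ , _ , _ , _ , _ , _ , g , _) = h z in g
  g₇ : ∀ z → GridAt z c₁ n₁ u
  g₇ z = let (_ , _ , _ , _ , _ , _ , _ , _ , _ , _ , _ , _ , _ , _ , _ , _ , g) = h z in g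

  h₀ = h [1]+[1]

  a₀-row = let (_ , _ , _ , _ , e , _) = h₀ in e
  b₁-row = let (_ , _ , _ , _ , _ , e , _) = h₀ in e
  c₁-row = let (_ , _ , _ , _ , _ , _ , e , _) = h₀ in e
  n₁-col = let (_ , _ , _ , _ , _ , _ , _ , e , _) = h₀ in e
  c≤n₁   = let (_ , _ , _ , _ , _ , _ , _ , _ , e , _) = h₀ in e
  n₁≤q   = let (_ , _ , _ , _ , _ , _ , _ , _ , _ , e , _) = h₀ in e
  a₁-row = let ((_ , _ , e , _) , _) = h₀ in e
  a₂-row = let (_ , (_ , _ , e , _) , _) = h₀ in e
  b₂-row = let (_ , _ , (_ , _ , e , _) , _) = h₀ in e
  n₂-col = let (_ , _ , _ , (_ , _ , e , _) , _) = h₀ in e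

  a₀₁ = row⇒ {a₀} a₀-row
  a₁₁ = row⇒ {a₁} a₁-row
  a₂₁ = row⇒ {a₂} a₂-row
  b₁₁ = row⇒ {b₁} b₁-row
  b₂₁ = row⇒ {b₂} b₂-row
  c₁₁ = row⇒ {c₁} c₁-row

  w-exists = nonempty-row {a₀} {n₂} {s⁻} a₀-row (g₄ [1]+[1])
  v-exists = nonempty-row {b₁} {n₁} {x} b₁-row (g₅ [1]+[1])
  z-exists = nonempty-row {c₁} {n₁} {u} c₁-row (g₇ [1]+[1])

  w = proj₁ w-exists
  v = proj₁ v-exists
  z = proj₁ z-exists

  a₀₀ = proj₂ w-exists
  b₁₀ = proj₂ v-exists
  c₁₀ = proj₂ z-exists
  a₁₀ = trans (next-row⇒ {a₀} {a₁} (λ z → proj₁ (h z))) (cong suc a₀₀)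
  a₂₀ = trans (next-row⇒ {a₁} {a₂} (λ z → proj₁ (proj₂ (h z)))) (cong suc a₁₀)
  b₂₀ = trans (next-row⇒ {b₁} {b₂} (λ z → proj₁ (proj₂ (proj₂ (h z))))) (cong suc b₁₀)

  n₁-column = column⇒ {n₁} n₁-col
  n₂-column = column⇒ {n₂} n₂-col

  -- The conjunct `corner ⊑ 𝕟₁` gives height at least 2, so the truncated subtraction is exact.
  t = height n₁ ∸ 2

  n₁-height : height n₁ ≡ 2 + t
  n₁-height = sym (m+[n∸m]≡n (!⇒height n₁ (proj₁ (corner-probe n₁) c≤n₁)))

  n₂-height : height n₂ ≡ 3 + t
  n₂-height = trans (next-column⇒ {d} d₀ d₁ {n₁} {n₂} (λ z → proj₁ (proj₂ (proj₂ (proj₂ (h z))))))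
                    (cong suc n₁-height)

module Completeness (M : Machine) (k : ℕ) (k-large : 21 + input M ≤ k)
                    (names : Every (λ x → termCode x ≤ k) (machineF M)) (reaches : Reaches M k) where

  open Sentences (input M)
  open Reaches reaches renaming (time to T)

  q-shape : Decreasing (shape T (λ _ → 0))
  q-shape = shape-decreasing T (λ _ → 0) λ _ _ → z≤n

  p-shape : ∀ g → Decreasing (shape T (λ t → history t g))
  p-shape g = shape-decreasing T (λ t → history t g) λ t t<T → growth t t<T g

  q : Partition
  q = fromFunction (suc T) (shape T (λ _ → 0)) q-shape

  p : ℕ → Partition
  p g = fromFunction (suc T) (shape T (λ t → history t g)) (p-shape g)

  q-! : ∀ t → q ! t ≡ shape T (λ _ → 0) t
  q-! = fromFunction-! (suc T) _ q-shape (shape-after T (λ _ → 0) ≤-refl)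

  p-! : ∀ g t → p g ! t ≡ shape T (λ t → history t g) t
  p-! g = fromFunction-! (suc T) _ (p-shape g) (shape-after T (λ t → history t g) ≤-refl)

  q-before : ∀ {t} → t ≤ T → q ! t ≡ suc (T ∸ t)
  q-before {t} t≤T = trans (q-! t) (trans (shape-before T _ t≤T) (+-identityʳ _))

  p-before : ∀ g {t} → t ≤ T → p g ! t ≡ q ! t + history t g
  p-before g {t} t≤T = trans (p-! g t)
    (trans (shape-before T _ t≤T) (cong (_+ history t g) (sym (q-before t≤T))))

  p-after : ∀ g {t} → T < t → p g ! t ≡ 0
  p-after g {t} T<t = trans (p-! g t) (shape-after T _ T<t)

  q-positive : ∀ {t} → 0 < q ! t → t ≤ T
  q-positive {t} 0<q with <-≤-connex T t
  ... | inj₁ T<t = contradiction (trans (q-! t) (shape-after T _ T<t)) (≢-sym (<⇒≢ 0<q))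
  ... | inj₂ t≤T = t≤T

  q-next : ∀ {t} → suc t ≤ T → q ! t ≡ suc (q ! suc t)
  q-next {t} t<T = trans (q-before (<⇒≤ t<T)) (cong suc (trans (+-∸-assoc 1 t<T) (sym (q-before t<T))))

  parameter : ℕ → Partition
  parameter zero          = row 2
  parameter (suc zero)    = q
  parameter (suc (suc g)) = p g

  chainRow : ℕ → Partition
  -- The chain has to end at the first part of `q`, which is `suc T`.
  chainRow i = row ((k ∸ i) + suc T)

  ρ : Vec Partition (size k)
  ρ = vector k parameter ++ vector (suc k) chainRow

  ρ-parameter : ∀ {i} → i < k → nthOr ρ i ≡ parameter i
  ρ-parameter {i} i<k = trans (nthOr-++ˡ (vector k parameter) _ i i<k) (nthOr-vector k parameter i i<k)

  ρ-chain : ∀ {i} → i ≤ k → nthOr ρ (i + k) ≡ chainRow i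
  ρ-chain {i} i≤k = trans (cong (nthOr ρ) (+-comm i k))
    (trans (nthOr-++ʳ (vector k parameter) (vector (suc k) chainRow) i)
           (nthOr-vector (suc k) chainRow i (s≤s i≤k)))

  -- The intended values, also of those registers that are not in ρ.
  intended : Vec Partition 16 → Partition → Name → Partition
  intended ps z 𝕕       = row 2
  intended ps z 𝕢       = q
  intended ps z (reg g) = p g
  intended ps z x       = assign ρ ps z (termCode x)

  intended-chain : Vec Partition 16 → Partition → ℕ → ChainName → Partition
  intended-chain ps z i (name x) = intended ps z x
  intended-chain ps z i (link j) = chainRow (j + i)

  below-k : ∀ {i} → 19 + i ≤ k → i < k
  below-k h = ≤-trans (s≤s (m≤n+m _ 18)) h

  intended-name : ∀ ps z z′ x → termCode x ≤ k → env (z′ ∷ z ∷ (ps ++ ρ)) (termCode x) ≡ intended ps z x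
  intended-name ps z z′ corner  _ = refl
  intended-name ps z z′ 𝕫       _ = refl
  intended-name ps z z′ 𝕕       h = trans (nthOr-++ʳ ps ρ 0) (ρ-parameter (below-k {0} h))
  intended-name ps z z′ 𝕢       h = trans (nthOr-++ʳ ps ρ 1) (ρ-parameter (below-k {1} h))
  intended-name ps z z′ (reg g) h = trans (nthOr-++ʳ ps ρ (2 + g)) (ρ-parameter (below-k {2 + g} h))
  intended-name ps z z′ 𝕪       _ = refl
  intended-name ps z z′ 𝕒₀      _ = refl
  intended-name ps z z′ 𝕒₁      _ = refl
  intended-name ps z z′ 𝕒₂      _ = refl
  intended-name ps z z′ 𝕓₁      _ = refl
  intended-name ps z z′ 𝕓₂      _ = refl
  intended-name ps z z′ 𝕔₁      _ = refl
  intended-name ps z z′ 𝕟₁      _ = refl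
  intended-name ps z z′ 𝕟₂      _ = refl
  intended-name ps z z′ 𝕣       _ = refl
  intended-name ps z z′ 𝕣⁺      _ = refl
  intended-name ps z z′ 𝕤       _ = refl
  intended-name ps z z′ 𝕤⁻      _ = refl
  intended-name ps z z′ 𝕥       _ = refl
  intended-name ps z z′ 𝕥⁺      _ = refl
  intended-name ps z z′ 𝕦       _ = refl

  k-chain : ∀ {i} → i ≤ 21 + input M → i ≤ k
  k-chain h = ≤-trans h k-large

  same-row : ∀ {x x′ y} → x ! 0 ≡ x′ ! 0 → IsRow y → (y ≤ʸ x → y ≤ʸ x′) × (y ≤ʸ x′ → y ≤ʸ x)
  same-row {x} {x′} {y} e y-row = half x x′ e , half x′ x (sym e)
    where
    half : ∀ x x′ → x ! 0 ≡ x′ ! 0 → y ≤ʸ x → y ≤ʸ x′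
    half x x′ e y≤x = row-≤ {y} {x′} (row⇒ {y} y-row) (≤-trans (≤ʸ⇒! {y} {x} y≤x 0) (≤-reflexive e))

  q-first : q ! 0 ≡ suc T
  q-first = q-before z≤n

  p-first : ∀ g → p g ! 0 ≡ q ! 0 + initial M k g
  p-first g = trans (p-before g z≤n) (cong (q ! 0 +_) (begins g))

  input-first : p (input M) ! 0 ≡ k + suc T
  input-first = trans (p-first (input M)) (trans (cong₂ _+_ q-first initial-input) (+-comm (suc T) k))
    where
    initial-input : initial M k (input M) ≡ k
    initial-input with input M ≟ input M | input M ≟ start M
    ... | yes _ | _ = refl
    ... | no ¬e | _ = contradiction refl ¬e

  module _ (ps : Vec Partition 16) (z : Partition) where

    first-holds : ⟦ firstF (input M) ⟧ (intended-chain ps z 0)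
    first-holds = same-row {chainRow 0} {p (input M)} {intended ps z 𝕪}
      (trans (row-! (k + suc T)) (sym input-first))

    last-holds : ⟦ lastF ⟧ (intended-chain ps z k)
    last-holds = same-row {chainRow k} {q} {intended ps z 𝕪}
      (trans (row-! ((k ∸ k) + suc T)) (trans (cong (_+ suc T) (n∸n≡0 k)) (sym q-first)))

    link-holds : ∀ i → i < k → ⟦ linkF ⟧ (intended-chain ps z i)
    link-holds i i<k rewrite +-∸-assoc 1 i<k =
      let m = (k ∸ suc i) + suc T
          x≤x′ , x′≰x , x′-row , least = next-row m (intended ps z 𝕪)
      in x′-row , x≤x′ , x′≰x , least

    two-holds : ⟦ twoF ⟧ (intended ps z)
    two-holds = ⇒row {row 2} refl , (λ h → <⇒≱ ≤-refl (≤ʸ⇒! {row 2} {[1]+[1]} h 0))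
      , λ y-row y≰c → row-≤ {row 2} {intended ps z 𝕪} refl
          (≰⇒> λ h → y≰c (row-≤ {intended ps z 𝕪} {[1]+[1]} (row⇒ {intended ps z 𝕪} y-row) h))

    goal-holds : ⟦ goalF M ⟧ (intended ps z)
    goal-holds = (λ h → <⇒≱ exceeds (≤ʸ⇒! {p (goal M)} {q} h T))
      , λ y-col y≤p → !⇒≤ʸ {y} {q} λ t → below y-col y≤p t (<-≤-connex T t)
      where
      y = intended ps z 𝕪

      exceeds : q ! T < p (goal M) ! T
      exceeds = ≤-trans (≤-trans (≤-reflexive (+-comm 1 (q ! T))) (+-monoʳ-≤ (q ! T) (n≢0⇒n>0 reached)))
                      (≤-reflexive (sym (p-before (goal M) ≤-refl)))

      below : ¬ row 2 ≤ʸ y → y ≤ʸ p (goal M) → ∀ t → T < t ⊎ t ≤ T → y ! t ≤ q ! t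
      below y-col y≤p t (inj₁ T<t) =
        ≤-trans (≤ʸ⇒! {y} {p (goal M)} y≤p t) (≤-trans (≤-reflexive (p-after (goal M) T<t)) z≤n)
      below y-col y≤p t (inj₂ t≤T) =
        ≤-trans (≤-trans (!-antitone y {0} {t} z≤n) (Columns.column⇒ {row 2} refl refl {y} y-col))
                (≤-trans (s≤s z≤n) (≤-reflexive (sym (q-before t≤T))))

    start-holds : ∀ g → ⟦ startF M g ⟧ (intended ps z)
    start-holds g with g ≟ input M | g ≟ start M | p-first g
    ... | yes _ | _     | _ = !⇒≤ʸ {[1]+[1]} {[1]+[1]} λ _ → ≤-refl
    ... | no _  | yes _ | e = same-row {p g} {p (input M)} {intended ps z 𝕪}
      (trans e (trans (cong (_+ k) q-first) (trans (+-comm (suc T) k) (sym input-first))))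
    ... | no _  | no _  | e = same-row {p g} {q} {intended ps z 𝕪} (trans e (+-identityʳ (q ! 0)))

  module Rules {y a₀ a₁ a₂ b₁ b₂ c₁ n₁ n₂ r r⁺ s s⁻ x x⁺ u : Partition} (z : Partition)
               (reads : Reading q r r⁺ s s⁻ x x⁺ u) where

    open Reading reads renaming (z to height-u)

    ps : Vec Partition 16
    ps = y ∷ a₀ ∷ a₁ ∷ a₂ ∷ b₁ ∷ b₂ ∷ c₁ ∷ n₁ ∷ n₂ ∷ r ∷ r⁺ ∷ s ∷ s⁻ ∷ x ∷ x⁺ ∷ u ∷ []

    t<T : suc t ≤ T
    t<T = q-positive later

    now : ∀ g → p g ! t ≡ q ! t + history t g
    now g = p-before g (<⇒≤ t<T)

    exactly : ∀ a b {m} → Probe a m t → Probe b (suc m) t → ∀ P → a ≤ʸ P × ¬ b ≤ʸ P → P ! t ≡ m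
    exactly a b a-probe b-probe P (a≤P , b≰P) =
      ≤-antisym (≮⇒≥ λ m<P → b≰P (proj₂ (b-probe P) m<P)) (proj₁ (a-probe P) a≤P)

    fires : ∀ R → u ≤ʸ p (flag R) × ¬ u ≤ʸ q → ⟦ testF (test R) ⟧ (intended ps z) → Fires R (history t)
    fires R (u≤p , u≰q) tested = nonzero , passes (test R) tested
      where
      nonzero : history t (flag R) ≢ 0
      nonzero e = u≰q (proj₂ (u-probe q) (≤-trans (proj₁ (u-probe (p (flag R))) u≤p)
        (≤-reflexive (trans (now (flag R)) (trans (cong (q ! t +_) e) (+-identityʳ (q ! t)))))))

      passes : ∀ T → ⟦ testF T ⟧ (intended ps z) → Passes T (history t)
      passes (equal m n) (m-reads , n-reads) = +-cancelˡ-≡ (q ! t) _ _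
        (trans (sym (now m)) (trans (trans (exactly x x⁺ x-probe x⁺-probe (p m) m-reads)
                                           (sym (exactly x x⁺ x-probe x⁺-probe (p n) n-reads))) (now n)))
      passes (above m n) (x≤m , x≰n) = +-cancelˡ-< (q ! t) _ _
        (subst₂ _<_ (now n) (now m) (≤-trans (≰⇒> λ h → x≰n (proj₂ (x-probe (p n)) h))
                                             (proj₁ (x-probe (p m)) x≤m)))

    keeps : ∀ P m → P ! t ≡ q ! t + m → P ! suc t ≡ q ! suc t + m →
            r ≤ʸ P × ¬ r⁺ ≤ʸ P → s⁻ ≤ʸ P × ¬ s ≤ʸ P
    keeps P m e e′ exact = proj₂ (s⁻-probe P) (≤-reflexive (sym P≡w))
                         , λ s≤P → <⇒≱ (s≤s (≤-reflexive P≡w)) (proj₁ (s-probe P) s≤P)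
      where
      P≡w : P ! suc t ≡ w
      P≡w = suc-injective (begin
        suc (P ! suc t)      ≡⟨ cong suc e′ ⟩
        suc (q ! suc t) + m  ≡⟨ cong (_+ m) (q-next t<T) ⟨
        q ! t + m            ≡⟨ e ⟨
        P ! t                ≡⟨ exactly r r⁺ r-probe r⁺-probe P exact ⟩
        suc w                ∎)
        where open ≡-Reasoning

    updates-hold : ∀ U g → history (suc t) g ≡ update U (history t g) →
                   ⟦ updateF U (reg g) ⟧ (intended ps z)
    updates-hold keep g e = keeps (p g) (history t g) (now g)
      (trans (p-before g t<T) (cong (q ! suc t +_) e))
    updates-hold bump g e exact = proj₂ (s-probe (p g)) (≤-reflexive (sym (begin
      p g ! suc t                     ≡⟨ p-before g t<T ⟩
      q ! suc t + history (suc t) g   ≡⟨ cong (q ! suc t +_) e ⟩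
      q ! suc t + suc (history t g)   ≡⟨ +-suc (q ! suc t) (history t g) ⟩
      suc (q ! suc t) + history t g   ≡⟨ cong (_+ history t g) (q-next t<T) ⟨
      q ! t + history t g             ≡⟨ now g ⟨
      p g ! t                         ≡⟨ exactly r r⁺ r-probe r⁺-probe (p g) exact ⟩
      suc w                           ∎)))
      where open ≡-Reasoning
    updates-hold reset g e =
        (λ s≤p → proj₂ (s-probe q) (subst (suc w ≤_) p≡q (proj₁ (s-probe (p g)) s≤p)))
      , (λ s≤q → proj₂ (s-probe (p g)) (subst (suc w ≤_) (sym p≡q) (proj₁ (s-probe q) s≤q)))
      where
      p≡q : p g ! suc t ≡ q ! suc t
      p≡q = trans (p-before g t<T) (trans (cong (q ! suc t +_) e) (+-identityʳ (q ! suc t)))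

    rule-holds : ∀ {R} → R ∈ rules M → ⟦ ruleF M R ⟧ (intended ps z)
    rule-holds {R} R∈ (flagged , tested) =
        keeps q 0 (sym (+-identityʳ (q ! t))) (sym (+-identityʳ (q ! suc t)))
      , ⇒⋀ corner (registers M) λ {g} _ →
          updates-hold (updates R g) g (obeys t t<T R∈ (fires R flagged tested) g)

  -- A classical choice of `𝕫`. If some z violates `layout`, it makes the implication vacuous and is
  -- itself the witness. Otherwise `layout` holds for all z, which turns the variables into true
  -- rectangles; then the rules hold and any partition, such as y, is a witness.
  machine-holds : ∀ ps → DoubleNegation (∃ λ z → ⟦ machineF M ⟧ (intended ps z))
  machine-holds (y ∷ a₀ ∷ a₁ ∷ a₂ ∷ b₁ ∷ b₂ ∷ c₁ ∷ n₁ ∷ n₂ ∷ r ∷ r⁺ ∷ s ∷ s⁻ ∷ x ∷ x⁺ ∷ u ∷ []) none =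
    none (y , holds y λ _ → ⇒⋀ corner (rules M) (Rules.rule-holds y reads))
    where
    ps = y ∷ a₀ ∷ a₁ ∷ a₂ ∷ b₁ ∷ b₂ ∷ c₁ ∷ n₁ ∷ n₂ ∷ r ∷ r⁺ ∷ s ∷ s⁻ ∷ x ∷ x⁺ ∷ u ∷ []

    holds : ∀ z → (⟦ layout ⟧ (intended ps z) → ⟦ ⋀ corner (rules M) (ruleF M) ⟧ (intended ps z)) →
            ⟦ machineF M ⟧ (intended ps z)
    holds z h = two-holds ps z , goal-holds ps z
      , ⇒⋀ corner (registers M) (λ {g} _ → start-holds ps z g) , h

    layouts : ∀ z → ⟦ layout ⟧ (intended ps z)
    layouts z = decidable-stable (⟦⟧? layout (intended ps z)) λ ¬layout →
      none (z , holds z λ h → contradiction h ¬layout)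

    reads : Reading q r r⁺ s s⁻ x x⁺ u
    reads = reading {row 2} {q} {a₀} {a₁} {a₂} {b₁} {b₂} {c₁} {n₁} {n₂} refl refl layouts

  sentence-holds : [] ⊨ sentence k (machineF M)
  sentence-holds = ⇒close (size k) (ρ ,
    ⇒prefix-all 16 {φ = quant ex (quant all (kernel k (machineF M)))} λ ps none →
      machine-holds ps λ (z , h) → none (z , λ z′ → kernel-holds ps z z′ h))
    where
    kernel-holds : ∀ ps z z′ → ⟦ machineF M ⟧ (intended ps z) →
                   (z′ ∷ z ∷ (ps ++ ρ)) ⊨ kernel k (machineF M)
    kernel-holds ps z z′ h =
        holds termCode (machineF M) (intended ps z)
          (Every-map (λ x → intended-name ps z z′ x) (machineF M) names) h
      , ⇒conjunction k
          (holds (chainCode k 0) (firstF (input M)) (intended-chain ps z 0)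
            ((refl , y≡) , ((y≡ , chain≡ 0 z≤n) , (y≡ , p≡)) , ((y≡ , p≡) , (y≡ , chain≡ 0 z≤n)))
            (first-holds ps z))
          (holds (chainCode k k) lastF (intended-chain ps z k)
            ((refl , y≡) , ((y≡ , chain≡ k ≤-refl) , (y≡ , q≡)) , ((y≡ , q≡) , (y≡ , chain≡ k ≤-refl)))
            (last-holds ps z))
          (λ i i<k → let l₀ = chain≡ i (<⇒≤ i<k) ; l₁ = chain≡ (suc i) i<k in
            holds (chainCode k i) linkF (intended-chain ps z i)
              ((refl , l₀) , (l₁ , l₀) , (l₀ , l₁) , (refl , y≡) , (y≡ , l₁) , (l₀ , y≡))
              (link-holds ps z i i<k))
      where
      holds : ∀ {V} (τ : V → ℕ) φ σ → Every (λ x → env (z′ ∷ z ∷ (ps ++ ρ)) (τ x) ≡ σ x) φ →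
              ⟦ φ ⟧ σ → (z′ ∷ z ∷ (ps ++ ρ)) ⊨ toFormula _ τ φ
      holds τ φ σ eqs h =
        subst id (sym (trans (⊨-toFormula (z′ ∷ z ∷ (ps ++ ρ)) τ φ) (⟦⟧-cong φ eqs))) h

      y≡ : env (z′ ∷ z ∷ (ps ++ ρ)) 3 ≡ intended ps z 𝕪
      y≡ = refl

      q≡ : env (z′ ∷ z ∷ (ps ++ ρ)) 20 ≡ q
      q≡ = intended-name ps z z′ 𝕢 (k-chain (m≤m+n 20 (suc (input M))))

      p≡ : env (z′ ∷ z ∷ (ps ++ ρ)) (21 + input M) ≡ p (input M)
      p≡ = intended-name ps z z′ (reg (input M)) k-large

      chain≡ : ∀ i → i ≤ k → env (z′ ∷ z ∷ (ps ++ ρ)) (19 + (i + k)) ≡ chainRow i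
      chain≡ i i≤k = trans (nthOr-++ʳ ps ρ (i + k)) (ρ-chain i≤k)

-- Diagonalisation

constant : ∀ {n} → ℕ → Rec n
constant zero    = comp zer []
constant (suc m) = comp succ (constant m ∷ [])

constant↓ : ∀ {n} m {xs : Vec ℕ n} → constant m [ xs ]↓ m
constant↓ zero    = comp↓ [] zer↓
constant↓ (suc m) = comp↓ (constant↓ m ∷ []) succ↓

sum : ∀ {n} → Rec n → Rec n → Rec n
sum f g = comp (prec (proj zero) (comp succ (proj (suc zero) ∷ []))) (f ∷ g ∷ [])

sum↓ : ∀ {n} {f g : Rec n} {xs a b} → f [ xs ]↓ a → g [ xs ]↓ b → sum f g [ xs ]↓ a + b
sum↓ f↓ g↓ = comp↓ (f↓ ∷ g↓ ∷ []) (go _)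
  where
  go : ∀ a {b} → prec (proj zero) (comp succ (proj (suc zero) ∷ [])) [ a ∷ b ∷ [] ]↓ a + b
  go zero    = prec↓-zero proj↓
  go (suc a) = prec↓-suc (go a) (comp↓ (proj↓ ∷ []) succ↓)

triangular : Rec 1
triangular = prec (constant 0) (sum (proj (suc zero)) (comp succ (proj zero ∷ [])))

triangular↓ : ∀ n → triangular [ n ∷ [] ]↓ triangle n
triangular↓ zero    = prec↓-zero (constant↓ 0)
triangular↓ (suc n) = prec↓-suc (triangular↓ n) (sum↓ proj↓ (comp↓ (proj↓ ∷ []) succ↓))

pairing : ∀ {n} → Rec n → Rec n → Rec n
pairing f g = sum (comp triangular (sum f g ∷ [])) g

pairing↓ : ∀ {n} {f g : Rec n} {xs a b} → f [ xs ]↓ a → g [ xs ]↓ b → pairing f g [ xs ]↓ pair a b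
pairing↓ f↓ g↓ = sum↓ (comp↓ (sum↓ f↓ g↓ ∷ []) (triangular↓ _)) g↓

iterated : ∀ {n} → ℕ → Rec n → Rec n → Rec n
iterated m f g = comp (prec (proj zero) (pairing (constant m) (proj (suc zero)))) (f ∷ g ∷ [])

iterated↓ : ∀ {n} m {f g : Rec n} {xs a b} → f [ xs ]↓ a → g [ xs ]↓ b →
            iterated m f g [ xs ]↓ times (pair m) a b
iterated↓ m f↓ g↓ = comp↓ (f↓ ∷ g↓ ∷ []) (go _)
  where
  go : ∀ a {b} →
       prec (proj zero) (pairing (constant m) (proj (suc zero))) [ a ∷ b ∷ [] ]↓ times (pair m) a b
  go zero    = prec↓-zero proj↓
  go (suc a) = prec↓-suc (go a) (pairing↓ (constant↓ m) proj↓)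

chainCoding : ∀ {n} → Rec n → Rec n → ChainName → Rec n
chainCoding k i (name x) = constant (termCode x)
chainCoding k i (link j) = sum (constant 19) (sum (constant j) (sum i k))

chainCoding↓ : ∀ {n} {κ ι : Rec n} {xs k i} → κ [ xs ]↓ k → ι [ xs ]↓ i →
               ∀ x → chainCoding κ ι x [ xs ]↓ chainCode k i x
chainCoding↓ k↓ i↓ (name x) = constant↓ (termCode x)
chainCoding↓ k↓ i↓ (link j) = sum↓ (constant↓ 19) (sum↓ (constant↓ j) (sum↓ i↓ k↓))

coding : ∀ {n} → (ChainName → Rec n) → Matrix ChainName → Rec n
coding f (a ⊑ b) = pairing (constant 0) (pairing (f a) (f b))
coding f (∼ φ)   = pairing (constant 2) (coding f φ)
coding f (φ ∧ ψ) = pairing (constant 3) (pairing (coding f φ) (coding f ψ))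
coding f (φ ⇒ ψ) = pairing (constant 5) (pairing (coding f φ) (coding f ψ))

coding↓ : ∀ {n} {f : ChainName → Rec n} {xs τ} → (∀ x → f x [ xs ]↓ τ x) →
          ∀ φ → coding f φ [ xs ]↓ code τ φ
coding↓ f↓ (a ⊑ b) = pairing↓ (constant↓ 0) (pairing↓ (f↓ a) (f↓ b))
coding↓ f↓ (∼ φ)   = pairing↓ (constant↓ 2) (coding↓ f↓ φ)
coding↓ f↓ (φ ∧ ψ) = pairing↓ (constant↓ 3) (pairing↓ (coding↓ f↓ φ) (coding↓ f↓ ψ))
coding↓ f↓ (φ ⇒ ψ) = pairing↓ (constant↓ 5) (pairing↓ (coding↓ f↓ φ) (coding↓ f↓ ψ))

-- The arguments are the number of conjuncts of the second kind and a parameter.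
conjoining : Rec 1 → Rec 1 → Rec 3 → Rec 2
conjoining f g h = prec (pairing (constant 3) (pairing f g))
                        (pairing (constant 3) (pairing h (proj (suc zero))))

conjoining↓ : ∀ {f g h k x z m} → f [ k ∷ [] ]↓ x → g [ k ∷ [] ]↓ z →
              (∀ i y → h [ i ∷ y ∷ k ∷ [] ]↓ m i) →
              ∀ i → conjoining f g h [ i ∷ k ∷ [] ]↓ conjunctionCode x z m i
conjoining↓ f↓ g↓ h↓ zero    = prec↓-zero (pairing↓ (constant↓ 3) (pairing↓ f↓ g↓))
conjoining↓ f↓ g↓ h↓ (suc i) =
  prec↓-suc (conjoining↓ f↓ g↓ h↓ i) (pairing↓ (constant↓ 3) (pairing↓ (h↓ i _) proj↓))

blocking : Rec 1 → Rec 1 → Rec 1 → Rec 1 → Rec 1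
blocking f g h h′ = iterated 7 f (iterated 6 g
  (pairing (constant 7) (pairing (constant 6) (pairing (constant 3) (pairing h h′)))))

blocking↓ : ∀ {f g h h′ xs n k x z} → f [ xs ]↓ n → g [ xs ]↓ k → h [ xs ]↓ x → h′ [ xs ]↓ z →
            blocking f g h h′ [ xs ]↓ blockCode n k x z
blocking↓ f↓ g↓ h↓ h′↓ = iterated↓ 7 f↓ (iterated↓ 6 g↓
  (pairing↓ (constant↓ 7) (pairing↓ (constant↓ 6) (pairing↓ (constant↓ 3) (pairing↓ h↓ h′↓)))))

module Diagonal (g : ℕ) where

  open Sentences g

  firstCoder lastCoder : Rec 1
  firstCoder = coding (chainCoding (proj zero) (constant 0)) (firstF g)
  lastCoder  = coding (chainCoding (proj zero) (proj zero)) lastF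

  linkCoder : Rec 3
  linkCoder = coding (chainCoding (proj (suc (suc zero))) (proj zero)) linkF

  firstCoder↓ : ∀ k → firstCoder [ k ∷ [] ]↓ code (chainCode k 0) (firstF g)
  firstCoder↓ k = coding↓ {τ = chainCode k 0} (chainCoding↓ {k = k} {0} proj↓ (constant↓ 0)) (firstF g)

  lastCoder↓ : ∀ k → lastCoder [ k ∷ [] ]↓ code (chainCode k k) lastF
  lastCoder↓ k = coding↓ {τ = chainCode k k} (chainCoding↓ {k = k} {k} proj↓ proj↓) lastF

  linkCoder↓ : ∀ k i y → linkCoder [ i ∷ y ∷ k ∷ [] ]↓ code (chainCode k i) linkF
  linkCoder↓ k i y = coding↓ {τ = chainCode k i} (chainCoding↓ {k = k} {i} proj↓ proj↓) linkF

  chainCoder : Rec 2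
  chainCoder = conjoining firstCoder lastCoder linkCoder

  chainCoder↓ : ∀ k i → chainCoder [ i ∷ k ∷ [] ]↓ chainCodes k i
  chainCoder↓ k = conjoining↓ {firstCoder} {lastCoder} {linkCoder}
    {x = code (chainCode k 0) (firstF g)} {code (chainCode k k) lastF}
    {λ i → code (chainCode k i) linkF}
    (firstCoder↓ k) (lastCoder↓ k) (linkCoder↓ k)

  -- Self-application: the argument is used both as the input k and, in the place of the matrix, as
  -- a code.
  diagonal : Rec 1
  diagonal = blocking (sum (proj zero) (comp succ (proj zero ∷ []))) (constant 16) (proj zero)
                      (comp chainCoder (proj zero ∷ proj zero ∷ []))

  diagonal↓ : ∀ k → diagonal [ k ∷ [] ]↓ sentenceCode k k
  diagonal↓ k = blocking↓ {n = size k} {16} {k} {chainCodes k k}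
    (sum↓ proj↓ (comp↓ (proj↓ ∷ []) succ↓)) (constant↓ 16) proj↓
    (comp↓ (proj↓ ∷ proj↓ ∷ []) (chainCoder↓ k k))

-- The contradiction

pair-> : ∀ a b → b < pair (suc a) b
pair-> a b = m<n+m b (≤-trans (s≤s z≤n) (m≤n+m (suc a + b) (triangle (a + b))))

-- The bound 21 is the term code of register 0, the input register of the final machine. The name
-- `𝕢`, with term code 20, occurs in the goal condition, and the tag 3 of the outer conjunction
-- makes the inequality strict.
code-large : ∀ {φ ψ g χ θ} → φ ≡ ψ ∧ (∼ reg g ⊑ 𝕢 ∧ χ) ∧ θ → 21 ≤ code termCode φ
code-large {ψ = ψ} {g} {χ} {θ} refl = ≤-trans
  (s≤s (≤-trans (proj₂ (proj₁ (proj₁ (names-≤-code termCode ((∼ reg g ⊑ 𝕢 ∧ χ) ∧ θ)))))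
                (pair-≥ʳ (code termCode ψ) _)))
  (pair-> 2 (pair (code termCode ψ) (code termCode ((∼ reg g ⊑ 𝕢 ∧ χ) ∧ θ))))

machine-code-large : ∀ M → 21 ≤ code termCode (machineF M)
machine-code-large M = code-large {machineF M} refl

-- A decision procedure f for the theory would be wrong about the sentence of
-- any φ whose truth at k = code φ is opposite to the prediction of f.
module _ (g : ℕ) (f : Rec 1) where

  open Sentences g
  open Diagonal g

  predictor : Rec 1
  predictor = comp f (diagonal ∷ [])

  diagonal-argument : ∀ φ k → k ≡ code termCode φ → 21 + g ≤ k →
    (Every (λ x → termCode x ≤ k) φ → predictor [ k ∷ [] ]↓ 0 → [] ⊨ sentence k φ) →
    (predictor [ k ∷ [] ]↓ 1 → ¬ [] ⊨ sentence k φ) →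
    ¬ f Decides Codes (Σ-Theory 4)
  diagonal-argument φ k refl k-large if-zero if-one decides = false true
    where
    S : Sentence
    S = sentence k φ

    predicted : ∀ {v} → f [ ⌜ S ⌝ ∷ [] ]↓ v → predictor [ k ∷ [] ]↓ v
    predicted f↓ = comp↓
      (subst (λ m → diagonal [ k ∷ [] ]↓ m) (sym (⌜sentence⌝ k k-large φ (names-≤-code termCode φ)))
             (diagonal↓ k) ∷ [])
      f↓

    -- If S were true, f would answer 1, and that answer makes S false. So f answers 0, which makes
    -- S true.
    false : ¬ [] ⊨ S
    false S-true =
      if-one (predicted (proj₁ (decides ⌜ S ⌝) (S , (sentence-Σ₄ k φ , S-true) , refl))) S-true

    not-coded : ¬ Codes (Σ-Theory 4) ⌜ S ⌝
    not-coded (ψ , (_ , ψ-true) , ⌜ψ⌝≡⌜S⌝) = false (subst ([] ⊨_) (⌜⌝-injective ψ S ⌜ψ⌝≡⌜S⌝) ψ-true)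

    true : [] ⊨ S
    true = if-zero (names-≤-code termCode φ) (predicted (proj₂ (decides ⌜ S ⌝) not-coded))

-- M and k are kept abstract here: the code of a concrete formula is a huge
-- numeral, which must not be evaluated.
machine-argument : ∀ f M k → k ≡ code termCode (machineF M) → 21 + input M ≤ k →
  (predictor (input M) f [ k ∷ [] ]↓ 0 → Reaches M k) →
  (predictor (input M) f [ k ∷ [] ]↓ 1 → Avoids M k) →
  ¬ f Decides Codes (Σ-Theory 4)
machine-argument f M k k≡ k-large if-zero if-one =
  diagonal-argument (input M) f (machineF M) k k≡ k-large
    (λ names f↓ → Completeness.sentence-holds M k k-large names (if-zero f↓))
    (λ f↓ S-true → close⇒ (size k) S-true λ (ρ , holds) → Soundness.impossible M k ρ holds (if-one f↓))
  where open Sentences (input M)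

-- The predictor depends on the input register, since the sentences mention it, and the machine is
-- built from the predictor. This is not circular: the input register of every flow-chart machine is
-- 0.
undecided : ∀ f k → k ≡ code termCode (machineF (accept-machine (predictor 0 f))) →
            ¬ f Decides Codes (Σ-Theory 4)
undecided f k k≡ = machine-argument f (accept-machine (predictor 0 f)) k k≡ k-large
  (zero⇒reaches (predictor 0 f) k k≢0) (one⇒avoids (predictor 0 f) k k≢0)
  where
  k-large : 21 ≤ k
  k-large = subst (21 ≤_) (sym k≡) (machine-code-large (accept-machine (predictor 0 f)))

  k≢0 : k ≢ 0
  k≢0 e = <⇒≢ (≤-trans (s≤s z≤n) k-large) (sym e)

theorem3p15 : Undecidable (Σ-Theory 4)
theorem3p15 (f , decides) = undecided f _ refl decides
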